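{- Let $n$ and $r$ be positive integers and let $C_n(r)$ denote the number of $r$-colored partitions $\Lambda$ of $[n]$ with $\mathrm{cr}(\Lambda)<2$ (i.e. with no two crossing arcs of the same color). Let $e_1,\dots,e_r$ be the unit coordinate vectors of $\mathbb{R}^r$. Then $C_n(r)$ equals the number of $(n-1)$-step walks in $\mathbb{N}^r$ (all points having nonnegative integer coordinates) from the origin to itself, where each step is chosen from the following $(r+1)^2$ distinct steps: $\pm e_i$ for $i\in[r]$ ($2r$ steps), $e_i-e_j$ for ordered pairs $i\neq j$ ($r^2-r$ steps), and $r+1$ distinct zero steps.
   Context: For a partition $P$ of $[n]=\{1,\dots,n\}$ (a set of disjoint nonempty blocks with union $[n]$), $\mathrm{Arc}(P)$ is the set of pairs $(i,j)$ with $i,j$ in the same block and $j$ the least element of that block greater than $i$. A sequence of arcs $(i_t,j_t)_{t\in[k]}$ is a $k$-crossing if $i_1<\dots<i_k<j_1<\dots<j_k$. An $r$-colored partition is $\Lambda=(P,\varphi)$ with $\varphi:\mathrm{Arc}(P)\to[r]$; $\mathrm{cr}(\Lambda)$ is the largest $k$ such that $P$ has a $k$-crossing whose arcs all have the same color under $\varphi$. -}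

module Defs where

open import Data.Bool using (Bool; true; false; _∧_; _∨_; not; if_then_else_)
open import Data.Nat using (ℕ; zero; suc; _∸_; _<ᵇ_; _≡ᵇ_)
open import Data.Fin using (Fin; toℕ)
open import Data.Integer as ℤ using (ℤ; 0ℤ; 1ℤ; -1ℤ)
open import Data.List as List using (List; []; _∷_; [_]; _++_; map; concatMap; filterᵇ; length; allFin; cartesianProduct)
open import Data.Bool.ListAction using (all; any)
open import Data.Nat.ListAction using (sum)
open import Data.Vec as Vec using (Vec; lookup; replicate; zipWith; toList)
open import Data.Product using (_×_; _,_; proj₁; proj₂)
open import Relation.Nullary.Decidable using (does)
open import Relation.Binary.PropositionalEquality using (_≡_)

allVecs : {A : Set} → List A → (n : ℕ) → List (Vec A n)
allVecs xs zero    = [ Vec.[] ]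
allVecs xs (suc n) = concatMap (λ x → map (x Vec.∷_) (allVecs xs n)) xs

count : {A : Set} → (A → Bool) → List A → ℕ
count p xs = length (filterᵇ (λ x → p x) xs)

allB : {A : Set} → List A → (A → Bool) → Bool
allB xs p = all p xs

anyB : {A : Set} → List A → (A → Bool) → Bool
anyB xs p = any p xs

_<F_ : {n : ℕ} → Fin n → Fin n → Bool
i <F j = toℕ i <ᵇ toℕ j

_=F_ : {n : ℕ} → Fin n → Fin n → Bool
i =F j = toℕ i ≡ᵇ toℕ j

_⇒B_ : Bool → Bool → Bool
a ⇒B b = not a ∨ b

-- Set partitions of [n] = Fin n.
-- A partition P is encoded by its "same block" relation: a boolean
-- matrix M with M i j = true iff i and j lie in the same block of P.
-- Partitions of [n] correspond bijectively to such matrices that are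
-- reflexive, symmetric and transitive.

Rel : ℕ → Set
Rel n = Vec (Vec Bool n) n

sameBlock : {n : ℕ} → Rel n → Fin n → Fin n → Bool
sameBlock M i j = lookup (lookup M i) j

isPartition : {n : ℕ} → Rel n → Bool
isPartition {n} M =
  allB (allFin n) (λ i → sameBlock M i i) ∧
  allB (allFin n) (λ i → allB (allFin n) (λ j →
     sameBlock M i j ⇒B sameBlock M j i)) ∧
  allB (allFin n) (λ i → allB (allFin n) (λ j → allB (allFin n) (λ k →
     (sameBlock M i j ∧ sameBlock M j k) ⇒B sameBlock M i k)))

partitions : (n : ℕ) → List (Rel n)
partitions n = filterᵇ (λ M → isPartition M)
                      (allVecs (allVecs (true ∷ false ∷ []) n) n)

isArc : {n : ℕ} → Rel n → Fin n → Fin n → Bool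
isArc {n} M i j =
  sameBlock M i j ∧ (i <F j) ∧
  allB (allFin n) (λ k → ((i <F k) ∧ (k <F j)) ⇒B not (sameBlock M i k))

arcs : {n : ℕ} → Rel n → List (Fin n × Fin n)
arcs {n} M = filterᵇ (λ a → isArc M (proj₁ a) (proj₂ a))
                    (cartesianProduct (allFin n) (allFin n))

-- an r-coloring φ : Arc(P) → [r], given as the vector of colors of the
-- arcs in the list 'arcs M'
Coloring : {n : ℕ} → Rel n → ℕ → Set
Coloring M r = Vec (Fin r) (length (arcs M))

arc : {n : ℕ} (M : Rel n) → Fin (length (arcs M)) → Fin n × Fin n
arc M a = List.lookup (arcs M) a

hasMono2Crossing : {n r : ℕ} (M : Rel n) → Coloring M r → Bool
hasMono2Crossing M φ =
  anyB (allFin _) (λ a → anyB (allFin _) (λ b →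
    let i₁ = proj₁ (arc M a) ; j₁ = proj₂ (arc M a)
        i₂ = proj₁ (arc M b) ; j₂ = proj₂ (arc M b)
    in (i₁ <F i₂) ∧ (i₂ <F j₁) ∧ (j₁ <F j₂) ∧ (lookup φ a =F lookup φ b)))

crLt2 : {n r : ℕ} (M : Rel n) → Coloring M r → Bool
crLt2 M φ = not (hasMono2Crossing M φ)

C : ℕ → ℕ → ℕ
C n r = sum (map (λ M → count (crLt2 M) (allVecs (allFin r) (length (arcs M))))
                      (partitions n))

data Step (r : ℕ) : Set where
  plus  : Fin r → Step r
  minus : Fin r → Step r
  diff  : Fin r → Fin r → Step r      -- e_i - e_j (only used with i ≠ j)
  stay  : Fin (suc r) → Step r

steps : (r : ℕ) → List (Step r)
steps r = map plus (allFin r) ++ map minus (allFin r) ++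
          concatMap (λ i → map (diff i)
             (filterᵇ (λ j → not (i =F j)) (allFin r)))
             (allFin r) ++
          map stay (allFin (suc r))

unit : {r : ℕ} → Fin r → Vec ℤ r
unit {r} i = Vec.tabulate (λ k → if k =F i then 1ℤ else 0ℤ)

disp : {r : ℕ} → Step r → Vec ℤ r
disp (plus i)   = unit i
disp (minus i)  = Vec.map ℤ.-_ (unit i)
disp (diff i j) = zipWith ℤ._-_ (unit i) (unit j)
disp (stay _)   = replicate _ 0ℤ

nonneg : {r : ℕ} → Vec ℤ r → Bool
nonneg v = allB (toList v) (λ x → 0ℤ ℤ.≤ᵇ x)

isZero : {r : ℕ} → Vec ℤ r → Bool
isZero v = allB (toList v) (λ x → (x ℤ.≤ᵇ 0ℤ) ∧ (0ℤ ℤ.≤ᵇ x))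

validFrom : {r k : ℕ} → Vec ℤ r → Vec (Step r) k → Bool
validFrom p Vec.[]       = isZero p
validFrom p (s Vec.∷ ss) =
  let q = zipWith ℤ._+_ p (disp s) in nonneg q ∧ validFrom q ss

W : ℕ → ℕ → ℕ
W k r = count (validFrom (replicate r 0ℤ)) (allVecs (steps r) k)

{-# OPTIONS --safe #-}

-- Record a coloured partition by its equivalence relation together with, for
-- each vertex j, the colour of the arc ending at j (if any).  Build it by adding
-- vertices on the left, allowing "pending" colours at block minima: colours of
-- arcs whose left endpoint is still to come.  When a new vertex opens an arc of
-- colour c, noncrossing forces it to end at the leftmost pending vertex of colour
-- c.  So adding a vertex lowers at most one coordinate of the vector of pending
-- counts (the arc it opens) and then raises at most one (the arc ending at it).
-- With D and U the corresponding transfer operators on functions of that vector,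
-- the closed structures on n vertices number ((D U)^n δ)(0) =
-- (D (U D)^(n-1) U δ)(0), where δ is the indicator of the origin.  Since U δ = δ
-- and (D F)(0) = F(0), this is ((U D)^(n-1) δ)(0), and one application of U D is
-- one step of the walk.
module Submission where

open import Defs
open import Data.Bool using (Bool; true; false; _∧_; not; if_then_else_; T; T?)
open import Data.Bool.Properties using (T-∧)
open import Data.Empty using (⊥-elim)
open import Data.Fin using (Fin; zero; suc; toℕ; _≟_; _<_)
open import Data.Fin.Properties using (toℕ-injective; any?; _<?_; <-cmp; <-trans; toℕ<n)
open import Data.Integer as ℤ using (ℤ; 0ℤ; 1ℤ; -1ℤ) renaming (+_ to pos; -_ to negate; _+_ to _+ℤ_; _-_ to _-ℤ_)
import Data.Integer.Properties as ℤ
open import Data.List as List using (List; []; _∷_; [_]; _++_; map; concatMap; filterᵇ; length; allFin; cartesianProduct)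
open import Data.List.Membership.Propositional using (_∈_; find; lose)
open import Data.List.Membership.Propositional.Properties using (∈-map⁺; ∈-map⁻; ∈-concatMap⁺; ∈-concatMap⁻; ∈-allFin; ∈-filter⁺; ∈-filter⁻; ∈-lookup; ∈-cartesianProduct⁺)
open import Data.List.Membership.Propositional.Properties.WithK using (unique∧set⇒bag)
open import Data.List.Properties using (map-++; map-∘; map-tabulate; length-map)
open import Data.List.Relation.Binary.BagAndSetEquality using (∼bag⇒↭)
open import Data.List.Relation.Binary.Permutation.Propositional.Properties using (↭-length)
open import Data.List.Relation.Unary.All as All using ([]; _∷_)
open import Data.List.Relation.Unary.All.Properties using (all⁺; all⁻)
open import Data.List.Relation.Unary.AllPairs using ([]; _∷_)
open import Data.List.Relation.Unary.Any as Any using (here; there)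
open import Data.List.Relation.Unary.Any.Properties using (any⁺; any⁻; lookup-index)
open import Data.List.Relation.Unary.Unique.Propositional using (Unique)
import Data.List.Relation.Unary.Unique.Propositional.Properties as Unique
open import Data.Maybe as Maybe using (Maybe; just; nothing; maybe′)
open import Data.Maybe.Properties using (just-injective; ≡-dec)
open import Data.Nat using (ℕ; zero; suc; _+_; z<s; s<s; s<s⁻¹; _∸_; _≥_; _≤_)
open import Data.Nat.ListAction using (sum)
open import Data.Nat.ListAction.Properties using (sum-++)
open import Data.Nat.Properties using (+-identityʳ; +-comm; ≡⇒≡ᵇ; ≡ᵇ⇒≡; +-suc; m+n≡0⇒n≡0; ≤-trans; ≤-reflexive; <⇒≤; +-monoʳ-≤; <⇒<ᵇ; <ᵇ⇒<; m≤m+n; <⇒≱)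
open import Data.Nat.Solver using (module +-*-Solver)
open import Data.Product using (_×_; _,_; proj₁; proj₂; ∃-syntax; uncurry)
open import Data.Product.Properties using (,-injectiveˡ; ,-injectiveʳ)
open import Data.Vec as Vec using (Vec; []; _∷_; lookup; replicate; zipWith; updateAt; _[_]≔_; tabulate)
open import Data.Vec.Properties using (tabulate∘lookup; tabulate-cong; lookup∘tabulate; lookup-map; lookup-zipWith; lookup-replicate; lookup∘updateAt; lookup∘updateAt′; lookup∘update; lookup∘update′; ∷-injective; map-replicate)
open import Function using (_∘_; id; case_of_; mk⇔; Equivalence)
open import Relation.Binary using (tri<; tri≈; tri>)
open import Relation.Binary.PropositionalEquality using (_≡_; _≢_; _≗_; refl; sym; trans; cong; cong₂; subst; module ≡-Reasoning)
open import Relation.Nullary using (yes; no; contradiction; ¬_; Dec; does; ¬?; _×-dec_)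
open import Relation.Nullary.Decidable using (decidable-stable)
open import Relation.Unary using (Decidable)

variable
  A B : Set
  n r : ℕ

-- Finite sums over lists.

𝟙 : Bool → ℕ
𝟙 true  = 1
𝟙 false = 0

∑ : List A → (A → ℕ) → ℕ
∑ xs f = sum (map f xs)

∑-cong-∈ : (xs : List A) {f g : A → ℕ} → (∀ x → x ∈ xs → f x ≡ g x) → ∑ xs f ≡ ∑ xs g
∑-cong-∈ []       f≡g = refl
∑-cong-∈ (x ∷ xs) f≡g = cong₂ _+_ (f≡g x (here refl)) (∑-cong-∈ xs (λ y → f≡g y ∘ there))

∑-cong : (xs : List A) {f g : A → ℕ} → (∀ x → f x ≡ g x) → ∑ xs f ≡ ∑ xs g
∑-cong xs f≡g = ∑-cong-∈ xs (λ x _ → f≡g x)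

∑-zero : (xs : List A) → ∑ xs (λ _ → 0) ≡ 0
∑-zero []       = refl
∑-zero (_ ∷ xs) = ∑-zero xs

∑-++ : (xs ys : List A) (f : A → ℕ) → ∑ (xs ++ ys) f ≡ ∑ xs f + ∑ ys f
∑-++ xs ys f = trans (cong sum (map-++ f xs ys)) (sum-++ (map f xs) (map f ys))

∑-map : (h : A → B) (xs : List A) (f : B → ℕ) → ∑ (map h xs) f ≡ ∑ xs (f ∘ h)
∑-map h xs f = cong sum (sym (map-∘ xs))

∑-concatMap : (h : A → List B) (xs : List A) (f : B → ℕ) →
              ∑ (concatMap h xs) f ≡ ∑ xs (λ x → ∑ (h x) f)
∑-concatMap h []       f = refl
∑-concatMap h (x ∷ xs) f = trans (∑-++ (h x) (concatMap h xs) f) (cong (_ +_) (∑-concatMap h xs f))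

∑-+ : (xs : List A) (f g : A → ℕ) → ∑ xs (λ x → f x + g x) ≡ ∑ xs f + ∑ xs g
∑-+ []       f g = refl
∑-+ (x ∷ xs) f g = trans (cong (f x + g x +_) (∑-+ xs f g))
  (solve 4 (λ a b c d → a :+ b :+ (c :+ d) := a :+ c :+ (b :+ d)) refl (f x) (g x) (∑ xs f) (∑ xs g))
  where open +-*-Solver

∑-filter : (p : A → Bool) (xs : List A) (f : A → ℕ) →
           ∑ (filterᵇ p xs) f ≡ ∑ xs (λ x → if p x then f x else 0)
∑-filter p []       f = refl
∑-filter p (x ∷ xs) f with p x
... | true  = cong (f x +_) (∑-filter p xs f)
... | false = ∑-filter p xs f

length-∑ : (xs : List A) → length xs ≡ ∑ xs (λ _ → 1)
length-∑ []       = refl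
length-∑ (_ ∷ xs) = cong suc (length-∑ xs)

count-∑ : (p : A → Bool) (xs : List A) → count p xs ≡ ∑ xs (𝟙 ∘ p)
count-∑ p xs = trans (length-∑ (filterᵇ p xs)) (trans (∑-filter p xs (λ _ → 1)) (∑-cong xs (λ x → eq (p x))))
  where
  eq : ∀ b → (if b then 1 else 0) ≡ 𝟙 b
  eq true  = refl
  eq false = refl

∑-allFin-suc : (f : Fin (suc n) → ℕ) → ∑ (allFin (suc n)) f ≡ f zero + ∑ (allFin n) (f ∘ suc)
∑-allFin-suc f = cong (λ xs → f zero + sum xs) (trans (map-tabulate suc f) (sym (map-tabulate id (f ∘ suc))))

-- Isolates the diagonal term: lowering the coordinate just raised gives a zero step, while the
-- steps `diff i j` run over `j` different from `i`.
∑-remove : (i : Fin n) (f : Fin n → ℕ) →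
           ∑ (allFin n) f ≡ f i + ∑ (filterᵇ (λ j → not (i =F j)) (allFin n)) f
∑-remove {n} i f = trans (go i f) (cong (f i +_) (sym (∑-filter (λ j → not (i =F j)) (allFin n) f)))
  where
  go : ∀ {n} (i : Fin n) (f : Fin n → ℕ) →
       ∑ (allFin n) f ≡ f i + ∑ (allFin n) (λ j → if not (i =F j) then f j else 0)
  go zero    f = trans (∑-allFin-suc f) (cong (f zero +_) (sym (∑-allFin-suc (λ j → if not (zero =F j) then f j else 0))))
  go {suc n} (suc i) f = begin
    ∑ (allFin _) f                         ≡⟨ ∑-allFin-suc f ⟩
    f zero + ∑ (allFin _) (f ∘ suc)        ≡⟨ cong (f zero +_) (go i (f ∘ suc)) ⟩
    f zero + (f (suc i) + rest)            ≡⟨ solve 3 (λ a b c → a :+ (b :+ c) := b :+ (a :+ c)) refl (f zero) (f (suc i)) rest ⟩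
    f (suc i) + (f zero + rest)            ≡⟨ cong (f (suc i) +_) (sym (∑-allFin-suc (λ j → if not (suc i =F j) then f j else 0))) ⟩
    f (suc i) + ∑ (allFin _) (λ j → if not (suc i =F j) then f j else 0) ∎
    where
    open ≡-Reasoning
    open +-*-Solver
    rest = ∑ (allFin n) (λ j → if not (i =F j) then f (suc j) else 0)

lookup-ext : {u v : Vec A n} → (∀ i → lookup u i ≡ lookup v i) → u ≡ v
lookup-ext {u = u} {v} eq = trans (sym (tabulate∘lookup u)) (trans (tabulate-cong eq) (tabulate∘lookup v))

-- Labels and the transfer operators.

Label : ℕ → Set
Label r = Maybe (Fin r)

labels : ∀ r → List (Label r)
labels r = nothing ∷ map just (allFin r)

∑-labels : (f : Label r → ℕ) → ∑ (labels r) f ≡ f nothing + ∑ (allFin r) (f ∘ just)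
∑-labels {r} f = cong (f nothing +_) (∑-map just (allFin r) f)

raise : Label r → Vec ℕ r → Vec ℕ r
raise nothing  q = q
raise (just i) q = updateAt q i suc

-- A list serves as a partial result: it is empty when the coordinate is already zero, so forbidden
-- moves contribute nothing to a sum.
lower : Label r → Vec ℕ r → List (Vec ℕ r)
lower nothing  q = [ q ]
lower (just i) q with lookup q i
... | zero  = []
... | suc m = [ q [ i ]≔ m ]

-- For a new leftmost vertex, `D` chooses the colour of the arc it opens and `U` the colour of the
-- arc ending at it. In both choices `nothing` stands for the absence of such an arc.
U D : (Vec ℕ r → ℕ) → Vec ℕ r → ℕ
U {r} F q = ∑ (labels r) (λ a → F (raise a q))
D {r} F q = ∑ (labels r) (λ o → ∑ (lower o q) F)

D-cong : {F G : Vec ℕ r → ℕ} → F ≗ G → D F ≗ D G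
D-cong F≗G q = ∑-cong (labels _) (λ o → ∑-cong (lower o q) F≗G)

origin : Vec ℕ r
origin = replicate _ 0

-- No coordinate of the origin can be lowered, so only the choice `nothing` survives.
D-origin : (F : Vec ℕ r → ℕ) → D F origin ≡ F origin
D-origin {r} F = trans (∑-labels (λ o → ∑ (lower o origin) F))
  (trans (cong₂ _+_ (+-identityʳ (F origin)) (trans (∑-cong (allFin r) none) (∑-zero (allFin r)))) (+-identityʳ (F origin)))
  where
  none : ∀ i → ∑ (lower (just i) origin) F ≡ 0
  none i rewrite lookup-replicate i 0 = refl

-- Walks as iterates of `U` after `D`.

point : Vec ℕ r → Vec ℤ r
point = Vec.map pos

-- Generalises `W` to an arbitrary starting point of the orthant, as the recursion on the first step
-- requires.
walks : ℕ → Vec ℕ r → ℕ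
walks {r} k q = count (validFrom (point q)) (allVecs (steps r) k)

unit-same : (i : Fin r) → lookup (unit i) i ≡ 1ℤ
unit-same {r} i = trans (lookup∘tabulate _ i) (cong (if_then 1ℤ else 0ℤ) (=F-refl i))
  where
  =F-refl : ∀ {r} (i : Fin r) → (i =F i) ≡ true
  =F-refl zero    = refl
  =F-refl (suc i) = =F-refl i

unit-other : {i k : Fin r} → k ≢ i → lookup (unit i) k ≡ 0ℤ
unit-other {i = i} {k} k≢i = trans (lookup∘tabulate _ k) (eq (k =F i) refl)
  where
  eq : ∀ b → (k =F i) ≡ b → (if b then 1ℤ else 0ℤ) ≡ 0ℤ
  eq false _ = refl
  eq true  e = contradiction (toℕ-injective (≡ᵇ⇒≡ _ _ (subst T (sym e) _))) k≢i

infixl 6 _⊞_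
_⊞_ : Vec ℤ r → Vec ℤ r → Vec ℤ r
_⊞_ = zipWith _+ℤ_

neg : Vec ℤ r → Vec ℤ r
neg = Vec.map negate

⊞-lookup : (u v : Vec ℤ r) (k : Fin r) → lookup (u ⊞ v) k ≡ lookup u k +ℤ lookup v k
⊞-lookup u v k = lookup-zipWith _+ℤ_ k u v

point-raise : (i : Fin r) (q : Vec ℕ r) → point (raise (just i) q) ≡ point q ⊞ unit i
point-raise i q = lookup-ext eq
  where
  eq : ∀ k → lookup (point (updateAt q i suc)) k ≡ lookup (point q ⊞ unit i) k
  eq k rewrite ⊞-lookup (point q) (unit i) k | lookup-map k pos q | lookup-map k pos (updateAt q i suc) with k ≟ i
  ... | yes refl rewrite unit-same i | lookup∘updateAt i {suc} q = cong pos (+-comm 1 (lookup q i))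
  ... | no k≢i rewrite unit-other k≢i | lookup∘updateAt′ k i {suc} k≢i q = sym (ℤ.+-identityʳ _)

point-lower : (j : Fin r) (q : Vec ℕ r) {m : ℕ} → lookup q j ≡ suc m →
              point q ⊞ neg (unit j) ≡ point (q [ j ]≔ m)
point-lower j q {m} q≡ = lookup-ext eq
  where
  eq : ∀ k → lookup (point q ⊞ neg (unit j)) k ≡ lookup (point (q [ j ]≔ m)) k
  eq k rewrite ⊞-lookup (point q) (neg (unit j)) k | lookup-map k pos q | lookup-map k pos (q [ j ]≔ m)
             | lookup-map k negate (unit j) with k ≟ j
  ... | yes refl rewrite unit-same j | lookup∘update j q m | q≡ = refl
  ... | no k≢j rewrite unit-other k≢j | lookup∘update′ k≢j q m = ℤ.+-identityʳ _

nonneg-point : (q : Vec ℕ r) → nonneg (point q) ≡ true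
nonneg-point []      = refl
nonneg-point (_ ∷ q) = nonneg-point q

nonneg-negative : (v : Vec ℤ r) (k : Fin r) → lookup v k ≡ -1ℤ → nonneg v ≡ false
nonneg-negative (_ ∷ v) zero    refl = refl
nonneg-negative (x ∷ v) (suc k) eq with 0ℤ ℤ.≤ᵇ x
... | true  = nonneg-negative v k eq
... | false = refl

-- A step factors as an optional raise followed by an optional lowering. Raising only gives `plus`,
-- lowering only gives `minus`, and both with distinct indices give `diff`. The `r` pairs with equal
-- indices, together with doing nothing, give the `r + 1` zero steps. Raising never leaves the
-- orthant, so only the endpoint needs a test.
walks-suc : (k : ℕ) (q : Vec ℕ r) → walks (suc k) q ≡ U (D (walks k)) q
walks-suc {r} k q = trans lhs (sym rhs)
  where
  open ≡-Reasoning
  z = point q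

  -- Extends `walks k` by zero to points outside the orthant, so that every combined step can be
  -- written as an integer translation.
  G : Vec ℤ r → ℕ
  G y = if nonneg y then count (validFrom y) (allVecs (steps r) k) else 0

  step : ∀ y → ∑ (allVecs (steps r) k) (λ ss → 𝟙 (nonneg y ∧ validFrom y ss)) ≡ G y
  step y with nonneg y
  ... | true  = sym (count-∑ (validFrom y) (allVecs (steps r) k))
  ... | false = ∑-zero (allVecs (steps r) k)

  G-point : ∀ p → walks k p ≡ G (point p)
  G-point p rewrite nonneg-point p = refl

  G-lower : ∀ j p → ∑ (lower (just j) p) (walks k) ≡ G (point p ⊞ neg (unit j))
  G-lower j p with lookup p j in p≡
  -- The translated point has `j`-th coordinate -1, so `G` vanishes just as the sum over the empty
  -- list does.
  ... | zero rewrite nonneg-negative (point p ⊞ neg (unit j)) j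
                 (trans (⊞-lookup (point p) (neg (unit j)) j)
                   (cong₂ _+ℤ_ (trans (lookup-map j pos p) (cong pos p≡))
                     (trans (lookup-map j negate (unit j)) (cong negate (unit-same j))))) = refl
  ... | suc m = trans (+-identityʳ _) (trans (G-point (p [ j ]≔ m)) (cong G (sym (point-lower j p p≡))))

  D-walks : ∀ p → D (walks k) p ≡ G (point p) + ∑ (allFin r) (λ j → G (point p ⊞ neg (unit j)))
  D-walks p = trans (∑-labels (λ o → ∑ (lower o p) (walks k)))
    (cong₂ _+_ (trans (+-identityʳ _) (G-point p)) (∑-cong (allFin r) (λ j → G-lower j p)))

  others : Fin r → List (Fin r)
  others i = filterᵇ (λ j → not (i =F j)) (allFin r)

  ups downs : ℕ
  ups   = ∑ (allFin r) (λ i → G (z ⊞ unit i))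
  downs = ∑ (allFin r) (λ j → G (z ⊞ neg (unit j)))
  diffs = ∑ (allFin r) (λ i → ∑ (others i) (λ j → G (z ⊞ zipWith _-ℤ_ (unit i) (unit j))))
  stays = ∑ (allFin r) (λ _ → G z)

  ⊞-zero : z ⊞ replicate r 0ℤ ≡ z
  ⊞-zero = lookup-ext λ i → trans (⊞-lookup z (replicate r 0ℤ) i)
    (trans (cong (lookup z i +ℤ_) (lookup-replicate i 0ℤ)) (ℤ.+-identityʳ _))

  ⊞-assoc-diff : ∀ i j → z ⊞ unit i ⊞ neg (unit j) ≡ z ⊞ zipWith _-ℤ_ (unit i) (unit j)
  ⊞-assoc-diff i j = lookup-ext λ l → begin
    lookup (z ⊞ unit i ⊞ neg (unit j)) l
      ≡⟨ ⊞-lookup (z ⊞ unit i) (neg (unit j)) l ⟩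
    lookup (z ⊞ unit i) l +ℤ lookup (neg (unit j)) l
      ≡⟨ cong₂ _+ℤ_ (⊞-lookup z (unit i) l) (lookup-map l negate (unit j)) ⟩
    lookup z l +ℤ lookup (unit i) l -ℤ lookup (unit j) l
      ≡⟨ ℤ.+-assoc (lookup z l) _ _ ⟩
    lookup z l +ℤ (lookup (unit i) l -ℤ lookup (unit j) l)
      ≡⟨ cong (lookup z l +ℤ_) (lookup-zipWith _-ℤ_ l (unit i) (unit j)) ⟨
    lookup z l +ℤ lookup (zipWith _-ℤ_ (unit i) (unit j)) l
      ≡⟨ ⊞-lookup z (zipWith _-ℤ_ (unit i) (unit j)) l ⟨
    lookup (z ⊞ zipWith _-ℤ_ (unit i) (unit j)) l ∎

  ⊞-cancel : ∀ i → z ⊞ unit i ⊞ neg (unit i) ≡ z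
  ⊞-cancel i = lookup-ext λ l → begin
    lookup (z ⊞ unit i ⊞ neg (unit i)) l
      ≡⟨ ⊞-lookup (z ⊞ unit i) (neg (unit i)) l ⟩
    lookup (z ⊞ unit i) l +ℤ lookup (neg (unit i)) l
      ≡⟨ cong₂ _+ℤ_ (⊞-lookup z (unit i) l) (lookup-map l negate (unit i)) ⟩
    lookup z l +ℤ lookup (unit i) l -ℤ lookup (unit i) l
      ≡⟨ ℤ.+-assoc (lookup z l) _ _ ⟩
    lookup z l +ℤ (lookup (unit i) l -ℤ lookup (unit i) l)
      ≡⟨ cong (lookup z l +ℤ_) (ℤ.+-inverseʳ (lookup (unit i) l)) ⟩
    lookup z l +ℤ 0ℤ
      ≡⟨ ℤ.+-identityʳ _ ⟩
    lookup z l ∎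

  lhs : walks (suc k) q ≡ ups + (downs + (diffs + (G z + stays)))
  lhs = begin
    walks (suc k) q
      ≡⟨ count-∑ (validFrom z) (allVecs (steps r) (suc k)) ⟩
    ∑ (allVecs (steps r) (suc k)) (𝟙 ∘ validFrom z)
      ≡⟨ ∑-concatMap (λ s → map (s ∷_) (allVecs (steps r) k)) (steps r) (𝟙 ∘ validFrom z) ⟩
    ∑ (steps r) (λ s → ∑ (map (s ∷_) (allVecs (steps r) k)) (𝟙 ∘ validFrom z))
      ≡⟨ ∑-cong (steps r) (λ s → trans (∑-map (s ∷_) (allVecs (steps r) k) (𝟙 ∘ validFrom z)) (step (z ⊞ disp s))) ⟩
    ∑ (steps r) g
      ≡⟨ ∑-++ (map plus (allFin r)) _ g ⟩
    ∑ (map plus (allFin r)) g + ∑ (map minus (allFin r) ++ diffSteps ++ staySteps) g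
      ≡⟨ cong₂ _+_ (∑-map plus (allFin r) g) (∑-++ (map minus (allFin r)) _ g) ⟩
    ups + (∑ (map minus (allFin r)) g + ∑ (diffSteps ++ staySteps) g)
      ≡⟨ cong (ups +_) (cong₂ _+_ (∑-map minus (allFin r) g) (∑-++ diffSteps staySteps g)) ⟩
    ups + (downs + (∑ diffSteps g + ∑ staySteps g))
      ≡⟨ cong (λ x → ups + (downs + x)) (cong₂ _+_ diffs≡ stays≡) ⟩
    ups + (downs + (diffs + (G z + stays))) ∎
    where
    g : Step r → ℕ
    g s = G (z ⊞ disp s)
    diffSteps = concatMap (λ i → map (diff i) (others i)) (allFin r)
    staySteps = map stay (allFin (suc r))
    diffs≡ : ∑ diffSteps g ≡ diffs
    diffs≡ = trans (∑-concatMap (λ i → map (diff i) (others i)) (allFin r) g)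
                   (∑-cong (allFin r) (λ i → ∑-map (diff i) (others i) g))
    -- One zero step is set apart to match the choice of no raise and no lowering. The other `r`
    -- will match raising and lowering the same coordinate.
    stays≡ : ∑ staySteps g ≡ G z + stays
    stays≡ = trans (∑-map stay (allFin (suc r)) g)
      (trans (∑-cong (allFin (suc r)) (λ _ → cong G ⊞-zero)) (∑-allFin-suc {r} (λ _ → G z)))

  raised : ∀ i → D (walks k) (raise (just i) q) ≡
           G (z ⊞ unit i) + (G z + ∑ (others i) (λ j → G (z ⊞ zipWith _-ℤ_ (unit i) (unit j))))
  raised i = begin
    D (walks k) (raise (just i) q)
      ≡⟨ D-walks (raise (just i) q) ⟩
    G (point (raise (just i) q)) + ∑ (allFin r) (λ j → G (point (raise (just i) q) ⊞ neg (unit j)))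
      ≡⟨ cong (λ y → G y + ∑ (allFin r) (λ j → G (y ⊞ neg (unit j)))) (point-raise i q) ⟩
    G (z ⊞ unit i) + ∑ (allFin r) (λ j → G (z ⊞ unit i ⊞ neg (unit j)))
      ≡⟨ cong (G (z ⊞ unit i) +_) (∑-remove i (λ j → G (z ⊞ unit i ⊞ neg (unit j)))) ⟩
    G (z ⊞ unit i) + (G (z ⊞ unit i ⊞ neg (unit i)) + ∑ (others i) (λ j → G (z ⊞ unit i ⊞ neg (unit j))))
      ≡⟨ cong (G (z ⊞ unit i) +_) (cong₂ _+_ (cong G (⊞-cancel i)) (∑-cong (others i) (λ j → cong G (⊞-assoc-diff i j)))) ⟩
    _ ∎

  rhs : U (D (walks k)) q ≡ ups + (downs + (diffs + (G z + stays)))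
  rhs = begin
    U (D (walks k)) q
      ≡⟨ ∑-labels (λ a → D (walks k) (raise a q)) ⟩
    D (walks k) q + ∑ (allFin r) (λ i → D (walks k) (raise (just i) q))
      ≡⟨ cong₂ _+_ (D-walks q) (∑-cong (allFin r) raised) ⟩
    G z + downs + ∑ (allFin r) (λ i → G (z ⊞ unit i) + (G z + _))
      ≡⟨ cong (G z + downs +_) (trans (∑-+ (allFin r) _ _) (cong (ups +_) (∑-+ (allFin r) _ _))) ⟩
    G z + downs + (ups + (stays + diffs))
      ≡⟨ solve 5 (λ g d u s f → g :+ d :+ (u :+ (s :+ f)) := u :+ (d :+ (f :+ (g :+ s)))) refl (G z) downs ups stays diffs ⟩
    ups + (downs + (diffs + (G z + stays))) ∎
    where open +-*-Solver

-- Identifies `walks 0` with the indicator function of the origin.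
walks-zero : (q : Vec ℕ r) → walks 0 q ≡ 𝟙 (isZero (point q))
walks-zero q = trans (count-∑ (validFrom (point q)) [ [] ]) (+-identityʳ _)

-- A raised vector is never the origin, so only the label `nothing` contributes.
U-walks-zero : (q : Vec ℕ r) → U (walks 0) q ≡ walks 0 q
U-walks-zero {r} q = trans (∑-labels (λ a → walks 0 (raise a q)))
  (trans (cong (walks 0 q +_) (trans (∑-cong (allFin r) none) (∑-zero (allFin r)))) (+-identityʳ _))
  where
  raised : ∀ {r} (i : Fin r) (q : Vec ℕ r) → isZero (point (updateAt q i suc)) ≡ false
  raised zero    (_ ∷ _)     = refl
  raised (suc i) (zero ∷ q)  = raised i q
  raised (suc i) (suc _ ∷ q) = refl
  none : ∀ i → walks 0 (raise (just i) q) ≡ 0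
  none i = trans (walks-zero (raise (just i) q)) (cong 𝟙 (raised i q))

-- Duplicate-free lists, least elements and counting in `Fin n`.

concatMap-unique : (f : A → List B) (xs : List A) → Unique xs →
                   (∀ {x} → x ∈ xs → Unique (f x)) →
                   (∀ {x y z} → x ∈ xs → y ∈ xs → z ∈ f x → z ∈ f y → x ≡ y) →
                   Unique (concatMap f xs)
concatMap-unique f []       _            _ _   = []
concatMap-unique f (x ∷ xs) (x∉xs ∷ uxs) u inj =
  Unique.++⁺ (u (here refl)) (concatMap-unique f xs uxs (u ∘ there) (λ y∈ z∈ → inj (there y∈) (there z∈)))
    λ (z∈fx , z∈rest) → let (y , y∈xs , z∈fy) = find (∈-concatMap⁻ f z∈rest) in
      All.lookup x∉xs y∈xs (inj (here refl) (there y∈xs) z∈fx z∈fy)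

T-ext : {a b : Bool} → (T a → T b) → (T b → T a) → a ≡ b
T-ext {true}  {true}  _ _ = refl
T-ext {true}  {false} f _ = ⊥-elim (f _)
T-ext {false} {true}  _ g = ⊥-elim (g _)
T-ext {false} {false} _ _ = refl

First : (Fin n → Set) → Fin n → Set
First P i = P i × (∀ k → k < i → ¬ P k)

first : {P : Fin n → Set} → Decidable P → Maybe (Fin n)
first {zero}  P? = nothing
first {suc n} P? with P? zero
... | yes _ = just zero
... | no  _ = Maybe.map suc (first (P? ∘ suc))

first-just : {P : Fin n → Set} (P? : Decidable P) {i : Fin n} → first P? ≡ just i → First P i
first-just {suc n} P? eq with P? zero
first-just {suc n} P? refl | yes p = p , λ _ ()
first-just {suc n} P? eq | no ¬p with first (P? ∘ suc) in eq′
first-just {suc n} P? refl | no ¬p | just i = let (p , least) = first-just (P? ∘ suc) eq′ in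
  p , λ { zero _ → ¬p ; (suc k) k<i → least k (s<s⁻¹ k<i) }

first-nothing : {P : Fin n → Set} (P? : Decidable P) → first P? ≡ nothing → ∀ k → ¬ P k
first-nothing {suc n} P? eq k with P? zero
first-nothing {suc n} P? eq k | no ¬p with first (P? ∘ suc) in eq′
first-nothing {suc n} P? eq zero    | no ¬p | nothing = ¬p
first-nothing {suc n} P? eq (suc k) | no ¬p | nothing = first-nothing (P? ∘ suc) eq′ k

First-unique : {P : Fin n → Set} {i j : Fin n} → First P i → First P j → i ≡ j
First-unique {i = i} {j} (p , l) (p′ , l′) with <-cmp i j
... | tri< i<j _ _ = contradiction p (l′ i i<j)
... | tri≈ _ i≡j _ = i≡j
... | tri> _ _ j<i = contradiction p′ (l j j<i)

first-First : {P : Fin n → Set} (P? : Decidable P) {i : Fin n} → First P i → first P? ≡ just i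
first-First P? {i} fi with first P? in eq
... | just j  = cong just (First-unique (first-just P? eq) fi)
... | nothing = contradiction (proj₁ fi) (first-nothing P? eq i)

cnt : {P : Fin n → Set} → Decidable P → ℕ
cnt {zero}  P? = 0
cnt {suc n} P? = 𝟙 (does (P? zero)) + cnt (P? ∘ suc)

𝟙-yes : {X : Set} (X? : Dec X) → X → 𝟙 (does X?) ≡ 1
𝟙-yes (yes _) _ = refl
𝟙-yes (no ¬x) x = contradiction x ¬x

𝟙-no : {X : Set} (X? : Dec X) → ¬ X → 𝟙 (does X?) ≡ 0
𝟙-no (yes x) ¬x = contradiction x ¬x
𝟙-no (no _)  _  = refl

𝟙-cong : {X Y : Set} (X? : Dec X) (Y? : Dec Y) → (X → Y) → (Y → X) → 𝟙 (does X?) ≡ 𝟙 (does Y?)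
𝟙-cong X? (yes y) f g = 𝟙-yes X? (g y)
𝟙-cong X? (no ¬y) f g = 𝟙-no X? (¬y ∘ f)

cnt-cong : {P Q : Fin n → Set} (P? : Decidable P) (Q? : Decidable Q) → (∀ i → P i → Q i) → (∀ i → Q i → P i) → cnt P? ≡ cnt Q?
cnt-cong {zero}  P? Q? f g = refl
cnt-cong {suc n} P? Q? f g =
  cong₂ _+_ (𝟙-cong (P? zero) (Q? zero) (f zero) (g zero)) (cnt-cong (P? ∘ suc) (Q? ∘ suc) (f ∘ suc) (g ∘ suc))

cnt-none : {P : Fin n → Set} (P? : Decidable P) → (∀ i → ¬ P i) → cnt P? ≡ 0
cnt-none {zero}  P? none = refl
cnt-none {suc n} P? none = cong₂ _+_ (𝟙-no (P? zero) (none zero)) (cnt-none (P? ∘ suc) (none ∘ suc))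

none-cnt : {P : Fin n → Set} (P? : Decidable P) → cnt P? ≡ 0 → ∀ i → ¬ P i
none-cnt {suc n} P? eq zero    p with P? zero
... | no ¬p = ¬p p
none-cnt {suc n} P? eq (suc i) p = none-cnt (P? ∘ suc) (m+n≡0⇒n≡0 (𝟙 (does (P? zero))) eq) i p

-- Applied when a new vertex joins a block: `P` describes the pending vertices of one colour before,
-- `Q` those after, and `j` is the minimum of the joined block.
cnt-remove : {P Q : Fin n → Set} (P? : Decidable P) (Q? : Decidable Q) (j : Fin n) → P j → ¬ Q j →
             (∀ i → Q i → P i) → (∀ i → i ≢ j → P i → Q i) → cnt P? ≡ suc (cnt Q?)
cnt-remove P? Q? zero    p ¬q g f = cong₂ _+_ (𝟙-yes (P? zero) p) (trans
  (cnt-cong (P? ∘ suc) (Q? ∘ suc) (λ i → f (suc i) λ ()) (g ∘ suc))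
  (cong (_+ cnt (Q? ∘ suc)) (sym (𝟙-no (Q? zero) ¬q))))
cnt-remove {suc n} P? Q? (suc j) p ¬q g f
  rewrite 𝟙-cong (P? zero) (Q? zero) (f zero λ ()) (g zero)
        | cnt-remove (P? ∘ suc) (Q? ∘ suc) j p ¬q (g ∘ suc) (λ i i≢j → f (suc i) λ { refl → i≢j refl })
  = +-suc (𝟙 (does (Q? zero))) (cnt (Q? ∘ suc))

-- Labelled equivalence relations and pending vertices.

infix 4 _∋_~_
_∋_~_ : Rel n → Fin n → Fin n → Set
M ∋ i ~ j = T (sameBlock M i j)

record IsEquivalence (M : Rel n) : Set where
  field
    reflexive  : ∀ i → M ∋ i ~ i
    symmetric  : ∀ {i j} → M ∋ i ~ j → M ∋ j ~ i
    transitive : ∀ {i j k} → M ∋ i ~ j → M ∋ j ~ k → M ∋ i ~ k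

Arc : Rel n → Fin n → Fin n → Set
Arc M i j = M ∋ i ~ j × i < j × (∀ k → i < k → k < j → ¬ M ∋ i ~ k)

-- These vertices are the right endpoints of arcs. Asking for any earlier block mate, rather than
-- the nearest one, makes the property easy to transport when a vertex is added.
NonMin : Rel n → Fin n → Set
NonMin M j = ∃[ i ] i < j × M ∋ i ~ j

nonMin? : (M : Rel n) (j : Fin n) → Dec (NonMin M j)
nonMin? M j = any? λ i → (i <? j) ×-dec T? (sameBlock M i j)

-- A labelled block minimum announces an arc whose left endpoint has not been added yet.
Pend : Rel n → Vec (Label r) n → Fin r → Fin n → Set
Pend M ℓ c j = ¬ NonMin M j × lookup ℓ j ≡ just c

pend? : (M : Rel n) (ℓ : Vec (Label r) n) (c : Fin r) → Decidable (Pend M ℓ c)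
pend? M ℓ c j = ¬? (nonMin? M j) ×-dec ≡-dec _≟_ (lookup ℓ j) (just c)

pending : Rel n → Vec (Label r) n → Vec ℕ r
pending M ℓ = tabulate λ c → cnt (pend? M ℓ c)

-- noncrossing also covers pending arcs: a pending k strictly inside the arc (i , j)
-- of its own colour would later be joined to a vertex left of i, creating a crossing.
record Valid (M : Rel n) (ℓ : Vec (Label r) n) : Set where
  field
    isEquivalence : IsEquivalence M
    labelled      : ∀ {j} → NonMin M j → ∃[ c ] lookup ℓ j ≡ just c
    noncrossing   : ∀ {i j k} → Arc M i j → i < k → k < j → lookup ℓ k ≡ lookup ℓ j →
                    ∃[ i′ ] i < i′ × i′ < k × M ∋ i′ ~ k
  open IsEquivalence isEquivalence public

-- Adding a vertex on the left.

extend : Vec Bool n → Rel n → Rel (suc n)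
extend row M = (true ∷ row) ∷ zipWith _∷_ row M

sameBlock-extend-suc-zero : (row : Vec Bool n) (M : Rel n) (i : Fin n) →
                            sameBlock (extend row M) (suc i) zero ≡ lookup row i
sameBlock-extend-suc-zero row M i = cong (λ v → lookup v zero) (lookup-zipWith Vec._∷_ i row M)

sameBlock-extend-suc-suc : (row : Vec Bool n) (M : Rel n) (i j : Fin n) →
                           sameBlock (extend row M) (suc i) (suc j) ≡ sameBlock M i j
sameBlock-extend-suc-suc row M i j = cong (λ v → lookup v (suc j)) (lookup-zipWith Vec._∷_ i row M)

-- The possible rows of a new vertex, indexed by the colour of the arc it opens. Only the leftmost
-- pending vertex of a colour may be reached, since passing over another would force a crossing of
-- that colour later. The new vertex then joins the whole block of `j`, whence the row `lookup M j`.
data Attach (M : Rel n) (ℓ : Vec (Label r) n) : Label r → Vec Bool n → Set where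
  alone : Attach M ℓ nothing (replicate n false)
  join  : ∀ {c j} → First (Pend M ℓ c) j → Attach M ℓ (just c) (lookup M j)

attach : Rel n → Vec (Label r) n → Label r → List (Vec Bool n)
attach M ℓ nothing  = [ replicate _ false ]
attach M ℓ (just c) = maybe′ (λ j → [ lookup M j ]) [] (first (pend? M ℓ c))

∈-attach⁻ : (M : Rel n) (ℓ : Vec (Label r) n) (o : Label r) {row : Vec Bool n} →
            row ∈ attach M ℓ o → Attach M ℓ o row
∈-attach⁻ M ℓ nothing  (here refl) = alone
∈-attach⁻ M ℓ (just c) row∈ with first (pend? M ℓ c) in eq
∈-attach⁻ M ℓ (just c) (here refl) | just j = join (first-just (pend? M ℓ c) eq)

∈-attach⁺ : {M : Rel n} {ℓ : Vec (Label r) n} {o : Label r} {row : Vec Bool n} →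
            Attach M ℓ o row → row ∈ attach M ℓ o
∈-attach⁺ alone = here refl
∈-attach⁺ {M = M} {ℓ} (join {c} fj) rewrite first-First (pend? M ℓ c) fj = here refl

minimal-unique : {M : Rel n} → IsEquivalence M → {i j : Fin n} →
                 ¬ NonMin M i → ¬ NonMin M j → M ∋ i ~ j → i ≡ j
minimal-unique eqv {i} {j} mi mj i~j with <-cmp i j
... | tri< i<j _ _ = contradiction (i , i<j , i~j) mj
... | tri≈ _ i≡j _ = i≡j
... | tri> _ _ j<i = contradiction (j , j<i , IsEquivalence.symmetric eqv i~j) mi

-- Collects what a row must satisfy for the extended structure to be valid. The first three fields
-- serve transitivity and labelling. The last concerns the new arc, which ends at the first entry of
-- the row: a vertex of the same colour below it must not be pending.
record Joinable (M : Rel n) (ℓ : Vec (Label r) n) (row : Vec Bool n) : Set where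
  field
    closed    : ∀ {i k} → T (lookup row i) → M ∋ i ~ k → T (lookup row k)
    together  : ∀ {i k} → T (lookup row i) → T (lookup row k) → M ∋ i ~ k
    coloured  : ∀ {k} → T (lookup row k) → ∃[ c ] lookup ℓ k ≡ just c
    uncovered : ∀ {j k} → First (T ∘ lookup row) j → k < j → lookup ℓ k ≡ lookup ℓ j → NonMin M k

-- In the `join` case, `j` is the minimum of its block, so the new arc ends at `j` itself. Since `j`
-- is the leftmost pending vertex of its colour, no earlier vertex of that colour is pending.
attach-joinable : {M : Rel n} {ℓ : Vec (Label r) n} → Valid M ℓ →
                  {o : Label r} {row : Vec Bool n} → Attach M ℓ o row → Joinable M ℓ row
attach-joinable {n} v alone = record
  { closed    = λ {i} x → ⊥-elim (empty i x)
  ; together  = λ {i} x → ⊥-elim (empty i x)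
  ; coloured  = λ {i} x → ⊥-elim (empty i x)
  ; uncovered = λ {j} (x , _) → ⊥-elim (empty j x)
  }
  where
  empty : ∀ i → ¬ T (lookup (replicate n false) i)
  empty i rewrite lookup-replicate i false = id
attach-joinable {M = M} {ℓ} v (join {c} {j} ((mj , ℓj) , least)) = record
  { closed    = transitive
  ; together  = λ x y → transitive (symmetric x) y
  ; coloured  = λ {k} → coloured
  ; uncovered = uncovered
  }
  where
  open Valid v
  coloured : ∀ {k} → M ∋ j ~ k → ∃[ c ] lookup ℓ k ≡ just c
  coloured {k} j~k with <-cmp j k
  ... | tri< j<k _ _  = labelled (j , j<k , j~k)
  ... | tri≈ _ refl _ = c , ℓj
  ... | tri> _ _ k<j  = contradiction (k , k<j , symmetric j~k) mj
  uncovered : ∀ {i k} → First (M ∋ j ~_) i → k < i → lookup ℓ k ≡ lookup ℓ i → NonMin M k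
  uncovered {i} {k} (j~i , l) k<i ℓk with <-cmp j i
  ... | tri< j<i _ _  = contradiction (reflexive j) (l j j<i)
  -- A minimal `k` would be an earlier pending vertex of colour `c`. Decidability turns this
  -- refutation into an actual earlier block mate of `k`.
  ... | tri≈ _ refl _ = decidable-stable (nonMin? M k) λ mk → least k k<i (mk , trans ℓk ℓj)
  ... | tri> _ _ i<j  = contradiction (i , i<j , symmetric j~i) mj

module Extend {n r : ℕ} (row : Vec Bool n) (M : Rel n) where

  N : Rel (suc n)
  N = extend row M

  s0⇒ : ∀ {i} → N ∋ suc i ~ zero → T (lookup row i)
  s0⇒ {i} = subst T (sameBlock-extend-suc-zero row M i)

  s0⇐ : ∀ {i} → T (lookup row i) → N ∋ suc i ~ zero
  s0⇐ {i} = subst T (sym (sameBlock-extend-suc-zero row M i))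

  ss⇒ : ∀ {i j} → N ∋ suc i ~ suc j → M ∋ i ~ j
  ss⇒ {i} {j} = subst T (sameBlock-extend-suc-suc row M i j)

  ss⇐ : ∀ {i j} → M ∋ i ~ j → N ∋ suc i ~ suc j
  ss⇐ {i} {j} = subst T (sym (sameBlock-extend-suc-suc row M i j))

  nonMin-old : ∀ {k} → NonMin M k → NonMin N (suc k)
  nonMin-old (i , i<k , i~k) = suc i , s<s i<k , ss⇐ i~k

  module _ {ℓ : Vec (Label r) n} (v : Valid M ℓ) (jn : Joinable M ℓ row) where
    open Valid v
    open Joinable jn

    extend-valid : ∀ a → Valid N (a ∷ ℓ)
    extend-valid a = record
      { isEquivalence = record
        { reflexive  = λ { zero → _ ; (suc i) → ss⇐ (reflexive i) }
        ; symmetric  = λ {i} {j} → symmetric′ i j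
        ; transitive = λ {i} {j} {k} → transitive′ i j k
        }
      ; labelled    = labelled′
      ; noncrossing = λ {i} {j} {k} → noncrossing′ i j k
      }
      where
      symmetric′ : ∀ i j → N ∋ i ~ j → N ∋ j ~ i
      symmetric′ zero    zero    _ = _
      symmetric′ zero    (suc j) x = s0⇐ x
      symmetric′ (suc i) zero    x = s0⇒ x
      symmetric′ (suc i) (suc j) x = ss⇐ (symmetric (ss⇒ x))
      transitive′ : ∀ i j k → N ∋ i ~ j → N ∋ j ~ k → N ∋ i ~ k
      transitive′ zero    zero    _       _ y = y
      transitive′ zero    (suc j) zero    _ _ = _
      transitive′ zero    (suc j) (suc k) x y = closed x (ss⇒ y)
      transitive′ (suc i) zero    zero    x _ = x
      transitive′ (suc i) zero    (suc k) x y = ss⇐ (together (s0⇒ x) y)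
      transitive′ (suc i) (suc j) zero    x y = s0⇐ (closed (s0⇒ y) (symmetric (ss⇒ x)))
      transitive′ (suc i) (suc j) (suc k) x y = ss⇐ (transitive (ss⇒ x) (ss⇒ y))
      labelled′ : ∀ {j} → NonMin N j → ∃[ c ] lookup (a ∷ ℓ) j ≡ just c
      labelled′ {suc j} (zero  , _   , x) = coloured x
      labelled′ {suc j} (suc i , i<j , x) = labelled (i , s<s⁻¹ i<j , ss⇒ x)
      noncrossing′ : ∀ i j k → Arc N i j → i < k → k < j → lookup (a ∷ ℓ) k ≡ lookup (a ∷ ℓ) j →
                     ∃[ i′ ] i < i′ × i′ < k × N ∋ i′ ~ k
      -- The arc starts at the new vertex, so any earlier old block mate of `k` already lies
      -- strictly between its start and `k`.
      noncrossing′ zero (suc j) (suc k) (x , _ , l) _ k<j eq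
        with i′ , i′<k , i′~k ← uncovered (x , λ m m<j → l (suc m) z<s (s<s m<j)) (s<s⁻¹ k<j) eq
        = suc i′ , z<s , s<s i′<k , ss⇐ i′~k
      noncrossing′ (suc i) (suc j) (suc k) (x , i<j , l) i<k k<j eq
        with i′ , i<i′ , i′<k , i′~k ← noncrossing
               (ss⇒ x , s<s⁻¹ i<j , λ m i<m m<j y → l (suc m) (s<s i<m) (s<s m<j) (ss⇐ y))
               (s<s⁻¹ i<k) (s<s⁻¹ k<j) eq
        = suc i′ , s<s i<i′ , s<s i′<k , ss⇐ i′~k

  unattached? : (ℓ : Vec (Label r) n) (c : Fin r) → Decidable λ k → Pend M ℓ c k × ¬ T (lookup row k)
  unattached? ℓ c k = pend? M ℓ c k ×-dec ¬? (T? (lookup row k))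

  δ : Label r → Fin r → ℕ
  δ a c = 𝟙 (does (≡-dec _≟_ a (just c)))

  -- The new vertex has nothing to its left, so it is a block minimum and contributes precisely its
  -- own label. An old pending vertex stays pending unless the new vertex enters its block.
  pending-extend : ∀ a (ℓ : Vec (Label r) n) c →
                   lookup (pending N (a ∷ ℓ)) c ≡ δ a c + cnt (unattached? ℓ c)
  pending-extend a ℓ c = trans (lookup∘tabulate _ c) (cong₂ _+_
    (𝟙-cong (pend? N (a ∷ ℓ) c zero) (≡-dec _≟_ a (just c)) proj₂ (λ eq → (λ ()) , eq))
    (cnt-cong (pend? N (a ∷ ℓ) c ∘ suc) (unattached? ℓ c)
      (λ k (m , eq) → (m ∘ nonMin-old , eq) , λ x → m (zero , z<s , x))
      (λ { k ((m , eq) , ¬x) → (λ { (zero , _ , x) → ¬x x ; (suc i , i<k , x) → m (i , s<s⁻¹ i<k , ss⇒ x) }) , eq })))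

  lookup-raise : ∀ a q c → lookup (raise a q) c ≡ δ a c + lookup q c
  lookup-raise nothing  q c = refl
  lookup-raise (just i) q c with i ≟ c
  ... | yes refl = lookup∘updateAt i q
  ... | no i≢c   = lookup∘updateAt′ c i (i≢c ∘ sym) q

  pending-raise : ∀ a (ℓ : Vec (Label r) n) q → (∀ c → cnt (unattached? ℓ c) ≡ lookup q c) →
                  pending N (a ∷ ℓ) ≡ raise a q
  pending-raise a ℓ q eq = lookup-ext λ c →
    trans (pending-extend a ℓ c) (trans (cong (δ a c +_) (eq c)) (sym (lookup-raise a q c)))

open Extend using (extend-valid; pending-raise; unattached?)

-- The combinatorial moves act on the pending counts as the operators do: opening an arc consumes
-- one pending vertex of its colour, then the label of the new vertex may create one.
∑-attach : {M : Rel n} {ℓ : Vec (Label r) n} → Valid M ℓ → (F : Vec ℕ r → ℕ) (o : Label r) →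
           ∑ (attach M ℓ o) (λ row → ∑ (labels r) (λ a → F (pending (extend row M) (a ∷ ℓ)))) ≡
           ∑ (lower o (pending M ℓ)) (U F)
∑-attach {n} {r} {M} {ℓ} v F nothing = cong (_+ 0) (∑-cong (labels r) λ a → cong F
  (pending-raise (replicate n false) M a ℓ (pending M ℓ) λ c →
    trans (cnt-cong (unattached? (replicate n false) M ℓ c) (pend? M ℓ c) (λ _ → proj₁)
            (λ k p → p , subst (¬_ ∘ T) (sym (lookup-replicate k false)) id))
          (sym (lookup∘tabulate _ c))))
∑-attach {n} {r} {M} {ℓ} v F (just c) with first (pend? M ℓ c) in eq
-- With no pending vertex of colour `c` the count is zero, so both sums are empty.
... | nothing rewrite lookup∘tabulate (λ c → cnt (pend? M ℓ c)) c
                    | cnt-none (pend? M ℓ c) (first-nothing (pend? M ℓ c) eq) = refl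
-- Only `j` ceases to be pending in colour `c`, as a block has a single minimum. The count is
-- therefore a successor, so `lower` is nonempty.
... | just j with (pj@(mj , ℓj) , least) ← first-just (pend? M ℓ c) eq
    rewrite lookup∘tabulate (λ c → cnt (pend? M ℓ c)) c
          | cnt-remove (pend? M ℓ c) (unattached? (lookup M j) M ℓ c) j pj
              (λ (_ , ¬j~j) → ¬j~j (Valid.reflexive v j)) (λ _ → proj₁)
              (λ i i≢j pi → pi , λ j~i → i≢j (sym (minimal-unique (Valid.isEquivalence v) mj (proj₁ pi) j~i)))
    = cong (_+ 0) (∑-cong (labels r) λ a → cong F
        (pending-raise (lookup M j) M a ℓ (pending M ℓ [ c ]≔ cnt (unattached? (lookup M j) M ℓ c)) same))
  where
  same : ∀ c′ → cnt (unattached? (lookup M j) M ℓ c′) ≡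
                lookup (pending M ℓ [ c ]≔ cnt (unattached? (lookup M j) M ℓ c)) c′
  same c′ with c′ ≟ c
  ... | yes refl = sym (lookup∘update c (pending M ℓ) _)
  -- Other colours keep their counts: the only minimum in the joined block is `j`, whose colour is
  -- `c`.
  ... | no c′≢c = trans
    (cnt-cong (unattached? (lookup M j) M ℓ c′) (pend? M ℓ c′) (λ _ → proj₁)
      (λ k (mk , ℓk) → (mk , ℓk) , λ j~k → c′≢c (just-injective (trans (sym ℓk)
        (trans (cong (lookup ℓ) (sym (minimal-unique (Valid.isEquivalence v) mj mk j~k))) ℓj)))))
    (trans (sym (lookup∘tabulate _ c′)) (sym (lookup∘update′ c′≢c (pending M ℓ) _)))

-- Generating the structures vertex by vertex.

Struct : ℕ → ℕ → Set
Struct r n = Rel n × Vec (Label r) n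

grow : Rel n → Vec (Label r) n → Vec Bool n → List (Struct r (suc n))
grow {r = r} M ℓ row = map (λ a → extend row M , a ∷ ℓ) (labels r)

extensions : Struct r n → List (Struct r (suc n))
extensions {r} (M , ℓ) = concatMap (λ o → concatMap (grow M ℓ) (attach M ℓ o)) (labels r)

structs : ∀ r n → List (Struct r n)
structs r zero    = [ [] , [] ]
structs r (suc n) = concatMap extensions (structs r n)

∈-labels : (a : Label r) → a ∈ labels r
∈-labels nothing  = here refl
∈-labels (just c) = there (∈-map⁺ just (∈-allFin c))

∈-extensions⁻ : (M : Rel n) (ℓ : Vec (Label r) n) {s : Struct r (suc n)} → s ∈ extensions (M , ℓ) →
                ∃[ o ] ∃[ row ] ∃[ a ] Attach M ℓ o row × s ≡ (extend row M , a ∷ ℓ)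
∈-extensions⁻ {r = r} M ℓ s∈
  with o , _ , s∈′ ← find (∈-concatMap⁻ (λ o → concatMap (grow M ℓ) (attach M ℓ o)) {labels r} s∈)
  with row , row∈ , s∈″ ← find (∈-concatMap⁻ (grow M ℓ) s∈′)
  with a , _ , s≡ ← ∈-map⁻ (λ a → extend row M , a ∷ ℓ) s∈″
  = o , row , a , ∈-attach⁻ M ℓ o row∈ , s≡

∈-extensions⁺ : {M : Rel n} {ℓ : Vec (Label r) n} {o a : Label r} {row : Vec Bool n} →
                Attach M ℓ o row → (extend row M , a ∷ ℓ) ∈ extensions (M , ℓ)
∈-extensions⁺ {M = M} {ℓ} {o} {a} {row} at =
  ∈-concatMap⁺ (λ o → concatMap (grow M ℓ) (attach M ℓ o)) (lose (∈-labels o)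
    (∈-concatMap⁺ (grow M ℓ) (lose (∈-attach⁺ at) (∈-map⁺ (λ a → extend row M , a ∷ ℓ) (∈-labels a)))))

structs-valid : {M : Rel n} {ℓ : Vec (Label r) n} → (M , ℓ) ∈ structs r n → Valid M ℓ
structs-valid {zero} (here refl) = record
  { isEquivalence = record { reflexive = λ () ; symmetric = λ {} ; transitive = λ {} }
  ; labelled      = λ {}
  ; noncrossing   = λ {}
  }
structs-valid {suc n} {r} s∈
  with (M , ℓ) , s′∈ , s∈ext ← find (∈-concatMap⁻ extensions {structs r n} s∈)
  with o , row , a , at , refl ← ∈-extensions⁻ M ℓ s∈ext
  = extend-valid row M (structs-valid s′∈) (attach-joinable (structs-valid s′∈) at) a

-- The transfer step. `D` is outermost because the opened arc acts on the old pending counts before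
-- the label of the new vertex is recorded.
∑-structs : (n : ℕ) (F : Vec ℕ r → ℕ) →
            ∑ (structs r (suc n)) (F ∘ uncurry pending) ≡ ∑ (structs r n) (D (U F) ∘ uncurry pending)
∑-structs {r} n F = trans (∑-concatMap extensions (structs r n) (F ∘ uncurry pending))
  (∑-cong-∈ (structs r n) λ (M , ℓ) s∈ →
    trans (∑-concatMap (λ o → concatMap (grow M ℓ) (attach M ℓ o)) (labels r) _)
    (∑-cong (labels r) λ o →
      trans (∑-concatMap (grow M ℓ) (attach M ℓ o) _)
      (trans (∑-cong (attach M ℓ o) λ row → ∑-map (λ a → extend row M , a ∷ ℓ) (labels r) _)
             (∑-attach (structs-valid s∈) F o))))

-- Removing the leftmost vertex.

minor : Rel (suc n) → Rel n
minor M = tabulate λ i → tabulate λ j → sameBlock M (suc i) (suc j)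

topRow : Rel (suc n) → Vec Bool n
topRow M = tabulate λ j → sameBlock M zero (suc j)

sameBlock-minor : (M : Rel (suc n)) (i j : Fin n) → sameBlock (minor M) i j ≡ sameBlock M (suc i) (suc j)
sameBlock-minor M i j = trans (cong (λ v → lookup v j) (lookup∘tabulate _ i)) (lookup∘tabulate _ j)

rel-ext : {M N : Rel n} → (∀ i j → sameBlock M i j ≡ sameBlock N i j) → M ≡ N
rel-ext eq = lookup-ext λ i → lookup-ext (eq i)

minor-extend : (row : Vec Bool n) (M : Rel n) → minor (extend row M) ≡ M
minor-extend row M = rel-ext λ i j → trans (sameBlock-minor (extend row M) i j) (sameBlock-extend-suc-suc row M i j)

topRow-extend : (row : Vec Bool n) (M : Rel n) → topRow (extend row M) ≡ row
topRow-extend row M = tabulate∘lookup row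

-- The first old vertex in the block of `zero` is where the arc from `zero` ends, and its label is
-- the colour opened. Noncrossing for this arc shows that no earlier vertex of that colour is
-- pending in the minor.
peel : {M : Rel (suc n)} {a : Label r} {ℓ : Vec (Label r) n} → Valid M (a ∷ ℓ) →
       Valid (minor M) ℓ × M ≡ extend (topRow M) (minor M) × ∃[ o ] Attach (minor M) ℓ o (topRow M)
peel {n} {r} {M} {a} {ℓ} v = minor-valid , extend≡ , attached
  where
  open Valid v
  M′ = minor M
  to : ∀ {i j} → M′ ∋ i ~ j → M ∋ suc i ~ suc j
  to {i} {j} = subst T (sameBlock-minor M i j)
  from : ∀ {i j} → M ∋ suc i ~ suc j → M′ ∋ i ~ j
  from {i} {j} = subst T (sym (sameBlock-minor M i j))

  minor-valid : Valid M′ ℓ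
  minor-valid = record
    { isEquivalence = record
      { reflexive  = λ i → from (reflexive (suc i))
      ; symmetric  = λ x → from (symmetric (to x))
      ; transitive = λ x y → from (transitive (to x) (to y))
      }
    ; labelled    = λ (i , i<j , x) → labelled (suc i , s<s i<j , to x)
    ; noncrossing = noncrossing′
    }
    where
    noncrossing′ : ∀ {i j k} → Arc M′ i j → i < k → k < j → lookup ℓ k ≡ lookup ℓ j →
                   ∃[ i′ ] i < i′ × i′ < k × M′ ∋ i′ ~ k
    noncrossing′ {i} {j} {k} (x , i<j , l) i<k k<j eq
      with noncrossing {suc i} {suc j} {suc k}
             (to x , s<s i<j , λ { (suc m) i<m m<j y → l m (s<s⁻¹ i<m) (s<s⁻¹ m<j) (from y) })
             (s<s i<k) (s<s k<j) eq
    -- The witness lies to the right of `suc i`, so it is not the deleted vertex.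
    ... | suc i′ , i<i′ , i′<k , y = i′ , s<s⁻¹ i<i′ , s<s⁻¹ i′<k , from y

  extend≡ : M ≡ extend (topRow M) M′
  -- Reflexivity supplies the corner entry that `extend` fixes as `true`, and symmetry the first
  -- column that it copies from the row.
  extend≡ = rel-ext λ
    { zero    zero    → T-ext _ (λ _ → reflexive zero)
    ; zero    (suc j) → sym (lookup∘tabulate _ j)
    ; (suc i) zero    → trans (T-ext symmetric symmetric)
        (trans (sym (lookup∘tabulate _ i)) (sym (sameBlock-extend-suc-zero (topRow M) M′ i)))
    ; (suc i) (suc j) → trans (sym (sameBlock-minor M i j)) (sym (sameBlock-extend-suc-suc (topRow M) M′ i j))
    }

  top? : Decidable λ j → M ∋ zero ~ suc j
  top? j = T? (sameBlock M zero (suc j))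

  attached : ∃[ o ] Attach M′ ℓ o (topRow M)
  attached with first top? in eq
  ... | nothing = nothing , subst (Attach M′ ℓ nothing) (sym empty) alone
    where
    empty : topRow M ≡ replicate n false
    empty = lookup-ext λ j → trans (lookup∘tabulate _ j)
      (trans (T-ext (first-nothing top? eq j) (λ ())) (sym (lookup-replicate j false)))
  ... | just j
    with (0~j , least) ← first-just top? eq
    with c , ℓj ← labelled {suc j} (zero , z<s , 0~j)
    = just c , subst (Attach M′ ℓ (just c)) row≡ (join ((minimal , ℓj) , uncovered))
    where
    row≡ : lookup M′ j ≡ topRow M
    row≡ = lookup-ext λ k → trans (T-ext (λ x → transitive 0~j (to x)) (λ x → from (transitive (symmetric 0~j) x)))
                                  (sym (lookup∘tabulate _ k))
    -- An earlier block mate of `j` would also be related to `zero`, against the choice of `j` as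
    -- first.
    minimal : ¬ NonMin M′ j
    minimal (i , i<j , x) = least i i<j (transitive 0~j (symmetric (to x)))
    uncovered : ∀ k → k < j → ¬ Pend M′ ℓ c k
    uncovered k k<j (mk , ℓk)
      with noncrossing {zero} {suc j} {suc k}
             (0~j , z<s , λ { (suc m) _ m<j → least m (s<s⁻¹ m<j) }) z<s (s<s k<j) (trans ℓk (sym ℓj))
    ... | suc i , _ , i<k , x = mk (i , s<s⁻¹ i<k , from x)

-- Completeness of the generation: peeling off the leftmost vertex leaves a valid structure, from
-- which one extension recovers the original.
valid-structs : {M : Rel n} {ℓ : Vec (Label r) n} → Valid M ℓ → (M , ℓ) ∈ structs r n
valid-structs {zero} {M = []} {[]} v = here refl
valid-structs {suc n} {r} {M} {a ∷ ℓ} v with v′ , M≡ , o , at ← peel v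
  = subst (λ N → (N , a ∷ ℓ) ∈ structs r (suc n)) (sym M≡)
      (∈-concatMap⁺ extensions (lose (valid-structs v′) (∈-extensions⁺ {a = a} at)))

-- Every structure is generated only once.

labels-unique : ∀ r → Unique (labels r)
labels-unique r = All.tabulate (λ a∈ nothing≡ → case ∈-map⁻ just a∈ of λ { (_ , _ , refl) → case nothing≡ of λ () })
  ∷ Unique.map⁺ just-injective (Unique.allFin⁺ r)

-- A row that is a block is nonempty by reflexivity, which separates `join` from `alone`. Otherwise
-- the colour is read off as the label of the unique minimum of that block.
attach-determines : {M : Rel n} {ℓ : Vec (Label r) n} → IsEquivalence M → {o o′ : Label r} {row : Vec Bool n} →
                    Attach M ℓ o row → Attach M ℓ o′ row → o ≡ o′
attach-determines {M = M} {ℓ} eqv {row = row} at at′ = go at at′ refl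
  where
  open IsEquivalence eqv
  nonempty : ∀ {j} → lookup M j ≢ replicate _ false
  nonempty {j} eq = subst T (trans (cong (λ v → lookup v j) eq) (lookup-replicate j false)) (reflexive j)
  go : ∀ {o o′ row row′} → Attach M ℓ o row → Attach M ℓ o′ row′ → row ≡ row′ → o ≡ o′
  go alone    alone    _  = refl
  go alone    (join _) eq = contradiction (sym eq) nonempty
  go (join _) alone    eq = contradiction eq nonempty
  go (join {j = j} ((mj , ℓj) , _)) (join {j = k} ((mk , ℓk) , _)) eq =
    trans (sym ℓj) (trans (cong (lookup ℓ) (minimal-unique eqv mj mk
      (subst (λ v → T (lookup v k)) (sym eq) (reflexive k)))) ℓk)

-- Each choice can be undone: `minor` and the tail of the labels recover the parent, `topRow` the
-- attached row, the row the opened colour, and the head of the labels the new label.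
structs-unique : ∀ r n → Unique (structs r n)
structs-unique r zero    = [] ∷ []
structs-unique r (suc n) = concatMap-unique extensions (structs r n) (structs-unique r n) unique determined
  where
  unique : ∀ {s} → s ∈ structs r n → Unique (extensions s)
  unique {M , ℓ} s∈ = concatMap-unique (λ o → concatMap (grow M ℓ) (attach M ℓ o)) (labels r) (labels-unique r)
    (λ {o} _ → concatMap-unique (grow M ℓ) (attach M ℓ o) (attach-unique o)
      (λ _ → Unique.map⁺ (λ eq → proj₁ (∷-injective (,-injectiveʳ eq))) (labels-unique r))
      (λ _ _ → same-row))
    λ {o} {o′} _ _ z∈ z∈′ → same-label o o′ z∈ z∈′
    where
    attach-unique : ∀ o → Unique (attach M ℓ o)
    attach-unique nothing = [] ∷ []
    attach-unique (just c) with first (pend? M ℓ c)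
    ... | nothing = []
    ... | just _  = [] ∷ []
    same-row : ∀ {row row′ z} → z ∈ grow M ℓ row → z ∈ grow M ℓ row′ → row ≡ row′
    same-row {row} {row′} z∈ z∈′
      with _ , _ , refl ← ∈-map⁻ (λ a → extend row M , a ∷ ℓ) z∈
      with _ , _ , eq ← ∈-map⁻ (λ a → extend row′ M , a ∷ ℓ) z∈′
      = trans (sym (topRow-extend row M)) (trans (cong topRow (,-injectiveˡ eq)) (topRow-extend row′ M))
    same-label : ∀ o o′ {z} → z ∈ concatMap (grow M ℓ) (attach M ℓ o) →
                 z ∈ concatMap (grow M ℓ) (attach M ℓ o′) → o ≡ o′
    same-label o o′ z∈ z∈′
      with row , row∈ , y∈ ← find (∈-concatMap⁻ (grow M ℓ) z∈)
      with row′ , row′∈ , y∈′ ← find (∈-concatMap⁻ (grow M ℓ) z∈′)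
      with refl ← same-row {row} {row′} y∈ y∈′
      = attach-determines (Valid.isEquivalence (structs-valid s∈)) (∈-attach⁻ M ℓ o row∈) (∈-attach⁻ M ℓ o′ row′∈)
  determined : ∀ {s t z} → s ∈ structs r n → t ∈ structs r n → z ∈ extensions s → z ∈ extensions t → s ≡ t
  determined {M , ℓ} {M′ , ℓ′} _ _ z∈ z∈′
    with _ , row , a , _ , refl ← ∈-extensions⁻ M ℓ z∈
    with _ , row′ , a′ , _ , eq ← ∈-extensions⁻ M′ ℓ′ z∈′
    = cong₂ _,_ (trans (sym (minor-extend row M)) (trans (cong minor (,-injectiveˡ eq)) (minor-extend row′ M′)))
                (proj₂ (∷-injective (,-injectiveʳ eq)))

-- Comparing duplicate-free lists by mutual inclusion.

length-unique : {xs ys : List A} → Unique xs → Unique ys → (∀ {x} → x ∈ xs → x ∈ ys) → (∀ {x} → x ∈ ys → x ∈ xs) →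
                length xs ≡ length ys
length-unique uxs uys to from = ↭-length (∼bag⇒↭ (unique∧set⇒bag uxs uys (mk⇔ to from)))

allVecs-complete : {xs : List A} → (∀ x → x ∈ xs) → (v : Vec A n) → v ∈ allVecs xs n
allVecs-complete all []      = here refl
allVecs-complete {n = suc n} {xs = xs} all (x ∷ v) =
  ∈-concatMap⁺ (λ x → map (x ∷_) (allVecs xs n)) (lose (all x) (∈-map⁺ (x ∷_) (allVecs-complete all v)))

allVecs-unique : {xs : List A} → Unique xs → ∀ n → Unique (allVecs xs n)
allVecs-unique u zero    = [] ∷ []
allVecs-unique {xs = xs} u (suc n) = concatMap-unique (λ x → map (x ∷_) (allVecs xs n)) xs u
  (λ _ → Unique.map⁺ (proj₂ ∘ ∷-injective) (allVecs-unique u n)) λ _ _ → same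
  where
  same : ∀ {x y v} → v ∈ map (x ∷_) (allVecs xs n) → v ∈ map (y ∷_) (allVecs xs n) → x ≡ y
  same {x} {y} v∈ v∈′ with _ , _ , refl ← ∈-map⁻ (x ∷_) v∈ with _ , _ , eq ← ∈-map⁻ (y ∷_) v∈′ = proj₁ (∷-injective eq)

lookup-unique : {xs : List A} → Unique xs → {i j : Fin (length xs)} → List.lookup xs i ≡ List.lookup xs j → i ≡ j
lookup-unique (_ ∷ _)  {zero}  {zero}  _  = refl
lookup-unique {xs = _ ∷ xs} (x∉ ∷ _) {zero}  {suc j} eq = contradiction eq (All.lookup x∉ (∈-lookup j))
lookup-unique {xs = _ ∷ xs} (x∉ ∷ _) {suc i} {zero}  eq = contradiction (sym eq) (All.lookup x∉ (∈-lookup i))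
lookup-unique (_ ∷ u)  {suc i} {suc j} eq = cong suc (lookup-unique u eq)

-- Boolean tests and the properties they decide.

∧-to : {a b : Bool} → T (a ∧ b) → T a × T b
∧-to = Equivalence.to T-∧

∧-from : {a b : Bool} → T a × T b → T (a ∧ b)
∧-from = Equivalence.from T-∧

⇒B-to : {a b : Bool} → T (a ⇒B b) → T a → T b
⇒B-to {true} b _ = b

⇒B-from : {a b : Bool} → (T a → T b) → T (a ⇒B b)
⇒B-from {true}  f = f _
⇒B-from {false} _ = _

not-to : {a : Bool} → T (not a) → ¬ T a
not-to {false} _ ()

not-from : {a : Bool} → ¬ T a → T (not a)
not-from {true}  f = ⊥-elim (f _)
not-from {false} _ = _

allB-to : {p : Fin n → Bool} → T (allB (allFin n) p) → ∀ i → T (p i)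
allB-to {n} {p} all i = All.lookup (all⁺ p (allFin n) all) (∈-allFin i)

allB-from : {p : Fin n → Bool} → (∀ i → T (p i)) → T (allB (allFin n) p)
allB-from {n} {p} f = all⁻ p {allFin n} (All.tabulate λ {i} _ → f i)

anyB-to : {p : Fin n → Bool} → T (anyB (allFin n) p) → ∃[ i ] T (p i)
anyB-to {p = p} any = Any.satisfied (any⁻ p (allFin _) any)

anyB-from : {p : Fin n → Bool} → ∀ i → T (p i) → T (anyB (allFin n) p)
anyB-from {p = p} i pi = any⁺ p (lose (∈-allFin i) pi)

isPartition-to : (M : Rel n) → T (isPartition M) → IsEquivalence M
isPartition-to M part = let (rfl , rest) = ∧-to part ; (sm , tr) = ∧-to rest in record
  { reflexive  = allB-to rfl
  ; symmetric  = λ {i} {j} → ⇒B-to (allB-to (allB-to sm i) j)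
  ; transitive = λ {i} {j} {k} x y → ⇒B-to (allB-to (allB-to (allB-to tr i) j) k) (∧-from (x , y))
  }

isPartition-from : (M : Rel n) → IsEquivalence M → T (isPartition M)
isPartition-from {n} M eqv = ∧-from (allB-from {n} reflexive , ∧-from
  ( allB-from {n} (λ i → allB-from {n} λ j → ⇒B-from symmetric)
  , allB-from {n} (λ i → allB-from {n} λ j → allB-from {n} λ k →
      ⇒B-from {sameBlock M i j ∧ sameBlock M j k} (uncurry transitive ∘ ∧-to))))
  where open IsEquivalence eqv

isArc-to : (M : Rel n) (i j : Fin n) → T (isArc M i j) → Arc M i j
isArc-to M i j arc = let (i~j , rest) = ∧-to arc ; (i<j , between) = ∧-to rest in
  i~j , <ᵇ⇒< _ _ i<j , λ k i<k k<j → not-to (⇒B-to (allB-to between k) (∧-from (<⇒<ᵇ i<k , <⇒<ᵇ k<j)))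

isArc-from : (M : Rel n) (i j : Fin n) → Arc M i j → T (isArc M i j)
isArc-from {n} M i j (i~j , i<j , between) = ∧-from (i~j , ∧-from (<⇒<ᵇ i<j , allB-from {n} λ k →
  ⇒B-from {(i <F k) ∧ (k <F j)} λ x →
    let (i<k , k<j) = ∧-to {i <F k} x in not-from (between k (<ᵇ⇒< _ _ i<k) (<ᵇ⇒< _ _ k<j))))

-- Arcs and their right endpoints.

module _ (M : Rel n) where

  source target : Fin (length (arcs M)) → Fin n
  source a = proj₁ (arc M a)
  target a = proj₂ (arc M a)

  isArc? : (a : Fin n × Fin n) → Dec (T (isArc M (proj₁ a) (proj₂ a)))
  isArc? a = T? (isArc M (proj₁ a) (proj₂ a))

  arc-Arc : ∀ a → Arc M (source a) (target a)
  arc-Arc a = isArc-to M (source a) (target a) (proj₂ (∈-filter⁻ isArc? {xs = cartesianProduct (allFin n) (allFin n)} (∈-lookup a)))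

  Arc-arc : ∀ {i j} → Arc M i j → ∃[ a ] arc M a ≡ (i , j)
  Arc-arc {i} {j} x = Any.index ij∈ , sym (lookup-index ij∈)
    where
    ij∈ : (i , j) ∈ arcs M
    ij∈ = ∈-filter⁺ isArc? (∈-cartesianProduct⁺ (∈-allFin i) (∈-allFin j)) (isArc-from M i j x)

  arc-injective : ∀ {a b} → arc M a ≡ arc M b → a ≡ b
  arc-injective = lookup-unique (Unique.filter⁺ isArc? (Unique.cartesianProduct⁺ (Unique.allFin⁺ n) (Unique.allFin⁺ n)))

module _ {M : Rel n} (eqv : IsEquivalence M) where
  open IsEquivalence eqv

  -- Of two different sources for `j`, the larger would be a block mate strictly inside the arc from
  -- the smaller.
  Arc-source-unique : ∀ {i i′ j} → Arc M i j → Arc M i′ j → i ≡ i′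
  Arc-source-unique {i} {i′} (i~j , i<j , l) (i′~j , i′<j , l′) with <-cmp i i′
  ... | tri< i<i′ _ _ = contradiction (transitive i~j (symmetric i′~j)) (l i′ i<i′ i′<j)
  ... | tri≈ _ i≡i′ _ = i≡i′
  ... | tri> _ _ i′<i = contradiction (transitive i′~j (symmetric i~j)) (l′ i i′<i i<j)

  -- This is what allows the colour of an arc to be stored at its right endpoint.
  target-injective : ∀ {a b} → target M a ≡ target M b → a ≡ b
  target-injective {a} {b} eq = arc-injective M (cong₂ _,_
    (Arc-source-unique (arc-Arc M a) (subst (Arc M (source M b)) (sym eq) (arc-Arc M b))) eq)

  nonMin-Arc : ∀ {j} → NonMin M j → ∃[ i ] Arc M i j
  nonMin-Arc {j} (i , i<j , i~j) = go n i i<j i~j (≤-trans (<⇒≤ (toℕ<n j)) (m≤m+n n (toℕ i)))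
    where
    -- The fuel `f` bounds the distance from `i` to `j` while `i` moves right to closer block mates.
    -- Starting with `n` suffices because `j` lies below `n`.
    go : ∀ f i → i < j → M ∋ i ~ j → toℕ j ≤ f + toℕ i → ∃[ i ] Arc M i j
    go zero    i i<j i~j j≤ = contradiction j≤ (<⇒≱ i<j)
    go (suc f) i i<j i~j j≤ with any? (λ k → (i <? k) ×-dec (k <? j) ×-dec T? (sameBlock M i k))
    ... | yes (k , i<k , k<j , i~k) = go f k k<j (transitive (symmetric i~k) i~j) (≤-trans j≤ (≤-trans (≤-reflexive (sym (+-suc f (toℕ i)))) (+-monoʳ-≤ f i<k)))
    ... | no none = i , i~j , i<j , λ k i<k k<j i~k → none (k , i<k , k<j , i~k)

-- Colourings of arcs as labels of vertices.

label : (M : Rel n) → Coloring M r → Vec (Label r) n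
label M φ = tabulate λ j → Maybe.map (lookup φ) (first λ a → target M a ≟ j)

label-arc : (M : Rel n) (φ : Coloring M r) {j : Fin n} {c : Fin r} → lookup (label M φ) j ≡ just c →
            ∃[ a ] target M a ≡ j × lookup φ a ≡ c
label-arc M φ {j} eq rewrite lookup∘tabulate (λ j → Maybe.map (lookup φ) (first λ a → target M a ≟ j)) j
  with first (λ a → target M a ≟ j) in eq′
... | just a = a , proj₁ (first-just (λ a → target M a ≟ j) eq′) , just-injective eq

label-unlabelled : (M : Rel n) (φ : Coloring M r) {j : Fin n} → lookup (label M φ) j ≡ nothing →
                   ∀ a → target M a ≢ j
label-unlabelled M φ {j} eq rewrite lookup∘tabulate (λ j → Maybe.map (lookup φ) (first λ a → target M a ≟ j)) j
  with first (λ a → target M a ≟ j) in eq′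
... | nothing = first-nothing (λ a → target M a ≟ j) eq′

-- Right endpoints determine arcs, so the first arc found by `label` at `target M a` is `a` itself.
label-target : {M : Rel n} → IsEquivalence M → (φ : Coloring M r) → ∀ a →
               lookup (label M φ) (target M a) ≡ just (lookup φ a)
label-target {M = M} eqv φ a with lookup (label M φ) (target M a) in eq
... | nothing = contradiction refl (label-unlabelled M φ eq a)
... | just c with b , tb , refl ← label-arc M φ eq = cong (just ∘ lookup φ) (target-injective eqv tb)

label-injective : {M : Rel n} → IsEquivalence M → {φ ψ : Coloring M r} → label M φ ≡ label M ψ → φ ≡ ψ
label-injective {M = M} eqv {φ} {ψ} eq = lookup-ext λ a → just-injective
  (trans (sym (label-target eqv φ a)) (trans (cong (λ ℓ → lookup ℓ (target M a)) eq) (label-target eqv ψ a)))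

crLt2-to : (M : Rel n) (φ : Coloring M r) → T (crLt2 M φ) → ∀ a b →
           source M a < source M b → source M b < target M a → target M a < target M b →
           lookup φ a ≢ lookup φ b
crLt2-to M φ cr a b p<p p<t t<t eq = not-to cr (anyB-from a (anyB-from b
  (∧-from (<⇒<ᵇ p<p , ∧-from (<⇒<ᵇ p<t , ∧-from (<⇒<ᵇ t<t , ≡⇒≡ᵇ _ _ (cong toℕ eq)))))))

crLt2-from : (M : Rel n) (φ : Coloring M r) →
             (∀ a b → source M a < source M b → source M b < target M a → target M a < target M b →
              lookup φ a ≢ lookup φ b) → T (crLt2 M φ)
crLt2-from M φ cr = not-from λ x →
  let (a , y) = anyB-to x
      (b , z) = anyB-to y
      (p<p , z₁) = ∧-to z
      (p<t , z₂) = ∧-to z₁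
      (t<t , eq) = ∧-to z₂
  in cr a b (<ᵇ⇒< _ _ p<p) (<ᵇ⇒< _ _ p<t) (<ᵇ⇒< _ _ t<t) (toℕ-injective (≡ᵇ⇒≡ _ _ eq))

-- Below an arc from `i` to `j`, a vertex `k` with the same label is the end of an arc of the same
-- colour. Its source lies right of `i`, or the two arcs would cross or share a source.
label-valid : {M : Rel n} → IsEquivalence M → (φ : Coloring M r) → T (crLt2 M φ) → Valid M (label M φ)
label-valid {M = M} eqv φ cr = record
  { isEquivalence = eqv
  ; labelled      = labelled
  ; noncrossing   = noncrossing
  }
  where
  labelled : ∀ {j} → NonMin M j → ∃[ c ] lookup (label M φ) j ≡ just c
  labelled m with _ , x ← nonMin-Arc eqv m with a , refl ← Arc-arc M x = lookup φ a , label-target eqv φ a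

  noncrossing : ∀ {i j k} → Arc M i j → i < k → k < j → lookup (label M φ) k ≡ lookup (label M φ) j →
                ∃[ i′ ] i < i′ × i′ < k × M ∋ i′ ~ k
  noncrossing {i} x i<k k<j ℓ≡
    with b , refl ← Arc-arc M x
    with a , refl , φ≡ ← label-arc M φ (trans ℓ≡ (label-target eqv φ b))
    with a~ , a< , between ← arc-Arc M a
    with <-cmp i (source M a)
  ... | tri< i<s _ _ = source M a , i<s , a< , a~
  -- A shared source would put `k` in the block of `i`, strictly inside the arc.
  ... | tri≈ _ i≡s _ = contradiction (subst (λ s → M ∋ s ~ target M a) (sym i≡s) a~) (proj₂ (proj₂ x) _ i<k k<j)
  ... | tri> _ _ s<i = contradiction φ≡ (crLt2-to M φ cr a b s<i i<k k<j)

label-closed : (M : Rel n) (φ : Coloring M r) → ∀ c j → ¬ Pend M (label M φ) c j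
label-closed M φ c j (m , ℓj) with a , refl , _ ← label-arc M φ ℓj =
  let (a~ , a< , _) = arc-Arc M a in m (source M a , a< , a~)

-- Each arc takes the label of its right endpoint. With no vertex pending, no label remains
-- elsewhere, so `label` returns the original labels.
closed-colouring : {M : Rel n} {ℓ : Vec (Label r) n} → Valid M ℓ → (∀ c j → ¬ Pend M ℓ c j) →
                   ∃[ φ ] T (crLt2 M φ) × label M φ ≡ ℓ
closed-colouring {n} {r} {M} {ℓ} v closed = φ , crLt2-from M φ nocross , lookup-ext label≡
  where
  open Valid v
  colour : ∀ a → ∃[ c ] lookup ℓ (target M a) ≡ just c
  colour a = let (a~ , a< , _) = arc-Arc M a in labelled (source M a , a< , a~)

  φ : Coloring M r
  φ = tabulate (proj₁ ∘ colour)

  ℓ-target : ∀ a → lookup ℓ (target M a) ≡ just (lookup φ a)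
  ℓ-target a = trans (proj₂ (colour a)) (cong just (sym (lookup∘tabulate (proj₁ ∘ colour) a)))

  nocross : ∀ a b → source M a < source M b → source M b < target M a → target M a < target M b →
            lookup φ a ≢ lookup φ b
  nocross a b p<p p<t t<t eq
    -- Noncrossing for arc `b`, with the end of `a` as inner vertex, yields a block mate of that end
    -- strictly inside `a`, which an arc forbids.
    with i , s<i , i<t , i~t ← noncrossing (arc-Arc M b) p<t t<t
           (trans (ℓ-target a) (trans (cong just eq) (sym (ℓ-target b))))
    = let (a~ , _ , between) = arc-Arc M a in
      between i (<-trans {i = source M a} p<p s<i) i<t (transitive a~ (symmetric i~t))

  label≡ : ∀ j → lookup (label M φ) j ≡ lookup ℓ j
  label≡ j with lookup (label M φ) j in eq
  ... | just c with a , refl , refl ← label-arc M φ eq = sym (ℓ-target a)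
  ... | nothing with lookup ℓ j in eq′
  ...   | nothing = refl
  -- No arc ends at `j`, so `j` is a block minimum, and its label would make it pending.
  ...   | just c  = contradiction (minimal , eq′) (closed c j)
    where
    minimal : ¬ NonMin M j
    minimal m with _ , x ← nonMin-Arc isEquivalence m with a , refl ← Arc-arc M x = label-unlabelled M φ eq a refl

-- Closed structures and coloured partitions.

isZero-to : (q : Vec ℕ r) → T (isZero (point q)) → ∀ c → lookup q c ≡ 0
isZero-to (zero ∷ q) z zero    = refl
isZero-to (zero ∷ q) z (suc c) = isZero-to q z c

isZero-from : (q : Vec ℕ r) → (∀ c → lookup q c ≡ 0) → T (isZero (point q))
isZero-from []          _  = _
isZero-from (zero ∷ q)  eq = isZero-from q (eq ∘ suc)
isZero-from (suc _ ∷ q) eq = contradiction (eq zero) λ ()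

isClosed : Struct r n → Bool
isClosed s = isZero (point (uncurry pending s))

isClosed-to : (M : Rel n) (ℓ : Vec (Label r) n) → T (isClosed (M , ℓ)) → ∀ c j → ¬ Pend M ℓ c j
isClosed-to M ℓ z c = none-cnt (pend? M ℓ c)
  (trans (sym (lookup∘tabulate _ c)) (isZero-to (pending M ℓ) z c))

isClosed-from : (M : Rel n) (ℓ : Vec (Label r) n) → (∀ c j → ¬ Pend M ℓ c j) → T (isClosed (M , ℓ))
isClosed-from M ℓ none = isZero-from (pending M ℓ) λ c →
  trans (lookup∘tabulate _ c) (cnt-none (pend? M ℓ c) (none c))

admissible : ∀ r (M : Rel n) → List (Coloring M r)
admissible r M = filterᵇ (crLt2 M) (allVecs (allFin r) (length (arcs M)))

colourings : ∀ r → Rel n → List (Struct r n)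
colourings r M = map (λ φ → M , label M φ) (admissible r M)

-- The objects counted by `C`, flattened into one list of structures so that they can be compared
-- with the closed members of `structs r n`.
coloured : ∀ r n → List (Struct r n)
coloured r n = concatMap (colourings r) (partitions n)

C-length : ∀ n r → C n r ≡ length (coloured r n)
C-length n r = sym (trans (length-∑ (coloured r n)) (trans (∑-concatMap (colourings r) (partitions n) _)
  (∑-cong (partitions n) λ M → trans (sym (length-∑ (colourings r M))) (length-map (λ φ → M , label M φ) (admissible r M)))))

rels : ∀ n → List (Rel n)
rels n = allVecs (allVecs (true ∷ false ∷ []) n) n

∈-partitions⁻ : {M : Rel n} → M ∈ partitions n → IsEquivalence M
∈-partitions⁻ {n} {M} M∈ = isPartition-to M (proj₂ (∈-filter⁻ (λ M → T? (isPartition M)) {xs = rels n} M∈))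

∈-partitions⁺ : {M : Rel n} → IsEquivalence M → M ∈ partitions n
∈-partitions⁺ {M = M} eqv = ∈-filter⁺ (λ M → T? (isPartition M))
  (allVecs-complete (allVecs-complete λ { true → here refl ; false → there (here refl) }) M) (isPartition-from M eqv)

partitions-unique : ∀ n → Unique (partitions n)
partitions-unique n = Unique.filter⁺ (λ M → T? (isPartition M))
  (allVecs-unique (allVecs-unique (((λ ()) ∷ []) ∷ [] ∷ []) n) n)

coloured-unique : ∀ r n → Unique (coloured r n)
coloured-unique r n = concatMap-unique (colourings r) (partitions n) (partitions-unique n)
  (λ {M} M∈ → Unique.map⁺ (label-injective (∈-partitions⁻ M∈) ∘ ,-injectiveʳ)
    (Unique.filter⁺ (λ φ → T? (crLt2 M φ)) (allVecs-unique (Unique.allFin⁺ r) (length (arcs M)))))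
  λ _ _ → same
  where
  same : ∀ {M N s} → s ∈ colourings r M → s ∈ colourings r N → M ≡ N
  same {M} {N} s∈ s∈′
    with _ , _ , refl ← ∈-map⁻ (λ φ → M , label M φ) s∈
    with _ , _ , eq ← ∈-map⁻ (λ φ → N , label N φ) s∈′ = ,-injectiveˡ eq

∈-colourings⁻ : {M : Rel n} {s : Struct r n} → s ∈ colourings r M →
                ∃[ φ ] T (crLt2 M φ) × s ≡ (M , label M φ)
∈-colourings⁻ {r = r} {M} s∈ =
  let (φ , φ∈ , s≡) = ∈-map⁻ (λ φ → M , label M φ) s∈
  in φ , proj₂ (∈-filter⁻ (λ φ → T? (crLt2 M φ)) {xs = allVecs (allFin r) (length (arcs M))} φ∈) , s≡

∈-colourings⁺ : {M : Rel n} {φ : Coloring M r} → T (crLt2 M φ) → (M , label M φ) ∈ colourings r M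
∈-colourings⁺ {M = M} {φ} cr =
  ∈-map⁺ (λ φ → M , label M φ) (∈-filter⁺ (λ φ → T? (crLt2 M φ)) (allVecs-complete ∈-allFin φ) cr)

coloured⊆closed : {s : Struct r n} → s ∈ coloured r n → s ∈ filterᵇ isClosed (structs r n)
coloured⊆closed {r} {n} s∈ =
  let (M , M∈ , s∈′) = find (∈-concatMap⁻ (colourings r) {partitions n} s∈)
      (φ , cr , s≡)  = ∈-colourings⁻ s∈′
  in subst (_∈ filterᵇ isClosed (structs r n)) (sym s≡)
       (∈-filter⁺ (T? ∘ isClosed) (valid-structs (label-valid (∈-partitions⁻ M∈) φ cr)) (isClosed-from M (label M φ) (label-closed M φ)))

closed⊆coloured : {s : Struct r n} → s ∈ filterᵇ isClosed (structs r n) → s ∈ coloured r n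
closed⊆coloured {r} {n} {M , ℓ} s∈ =
  let (s∈′ , cl)    = ∈-filter⁻ (T? ∘ isClosed) {xs = structs r n} s∈
      v             = structs-valid s∈′
      (φ , cr , ℓ≡) = closed-colouring v (isClosed-to M ℓ cl)
  in subst (λ ℓ → (M , ℓ) ∈ coloured r n) ℓ≡
       (∈-concatMap⁺ (colourings r) (lose (∈-partitions⁺ (Valid.isEquivalence v)) (∈-colourings⁺ {φ = φ} cr)))

-- From coloured partitions to walks.

C-structs : ∀ n r → C n r ≡ ∑ (structs r n) (walks 0 ∘ uncurry pending)
C-structs n r = begin
  C n r
    ≡⟨ C-length n r ⟩
  length (coloured r n)
    ≡⟨ length-unique (coloured-unique r n) (Unique.filter⁺ (T? ∘ isClosed) (structs-unique r n)) coloured⊆closed closed⊆coloured ⟩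
  count isClosed (structs r n)
    ≡⟨ count-∑ isClosed (structs r n) ⟩
  ∑ (structs r n) (𝟙 ∘ isClosed)
    ≡⟨ ∑-cong (structs r n) (λ (M , ℓ) → sym (walks-zero (pending M ℓ))) ⟩
  ∑ (structs r n) (walks 0 ∘ uncurry pending) ∎
  where open ≡-Reasoning

-- Each removed vertex turns the pair `U`, `D` into one more walk step, accumulated in `k`. The
-- leading `D` survives until no vertex is left, where all pending counts are zero and it acts
-- trivially.
∑-structs-walks : (n k : ℕ) → ∑ (structs r n) (D (walks k) ∘ uncurry pending) ≡ walks (n + k) (origin {r})
∑-structs-walks {r} zero k = begin
  D (walks k) (pending [] []) + 0 ≡⟨ +-identityʳ _ ⟩
  D (walks k) (pending [] [])     ≡⟨ cong (D (walks k)) (lookup-ext λ c → trans (lookup∘tabulate _ c) (sym (lookup-replicate c 0))) ⟩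
  D (walks k) origin              ≡⟨ D-origin (walks k) ⟩
  walks k origin                  ∎
  where open ≡-Reasoning
∑-structs-walks {r} (suc n) k = begin
  ∑ (structs r (suc n)) (D (walks k) ∘ uncurry pending)
    ≡⟨ ∑-structs n (D (walks k)) ⟩
  ∑ (structs r n) (D (U (D (walks k))) ∘ uncurry pending)
    ≡⟨ ∑-cong (structs r n) (λ (M , ℓ) → D-cong (λ q → sym (walks-suc k q)) (pending M ℓ)) ⟩
  ∑ (structs r n) (D (walks (suc k)) ∘ uncurry pending)
    ≡⟨ ∑-structs-walks {r} n (suc k) ⟩
  walks (n + suc k) (origin {r})
    ≡⟨ cong (λ m → walks m (origin {r})) (+-suc n k) ⟩
  walks (suc n + k) (origin {r}) ∎
  where open ≡-Reasoning

point-origin : point (origin {r}) ≡ replicate r 0ℤ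
point-origin = map-replicate pos 0 _

theorem1p6 : (n r : ℕ) → n ≥ 1 → r ≥ 1 → C n r ≡ W (n ∸ 1) r
theorem1p6 (suc n) r _ _ = begin
  C (suc n) r
    ≡⟨ C-structs (suc n) r ⟩
  ∑ (structs r (suc n)) (walks 0 ∘ uncurry pending)
    ≡⟨ ∑-structs n (walks 0) ⟩
  ∑ (structs r n) (D (U (walks 0)) ∘ uncurry pending)
    -- The innermost `U` fixes the indicator of the origin. One vertex is thus spent without
    -- producing a step, so `suc n` vertices give `n` steps.
    ≡⟨ ∑-cong (structs r n) (λ (M , ℓ) → D-cong U-walks-zero (pending M ℓ)) ⟩
  ∑ (structs r n) (D (walks 0) ∘ uncurry pending)
    ≡⟨ ∑-structs-walks {r} n 0 ⟩
  walks (n + 0) (origin {r})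
    ≡⟨ cong (λ m → walks m (origin {r})) (+-identityʳ n) ⟩
  walks n (origin {r})
    ≡⟨ cong (λ p → count (validFrom p) (allVecs (steps r) n)) point-origin ⟩
  W n r ∎
  where open ≡-Reasoning
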